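{- Let $G \in \mathcal{C}$. Then $G$ is a $4$-$\chi_\rho$-critical graph if and only if $G$ is one of the following graphs: (1) $G \cong C_n$ with $n \geq 5$ and $n \not\equiv 0 \pmod 4$; (2) $G$ is the net graph; (3) $G$ is obtained by attaching a single leaf to each of two adjacent vertices of $C_4$.
   Context: Graphs are finite and simple. $\mathcal{C}$ is the class of graphs that contain exactly one cycle and are obtained from a cycle by attaching an arbitrary number (possibly zero) of leaves (pendant vertices of degree 1) to each vertex of the cycle. The net graph is obtained by attaching a single leaf to each vertex of $C_3$. A $k$-packing coloring of $G$ is a map $c:V(G)\to\{1,\ldots,k\}$ such that two distinct vertices $u,v$ with $c(u)=c(v)=i$ satisfy $d_G(u,v)>i$ (distance between vertices in different components is infinite); $\chi_\rho(G)$ is the smallest $k$ for which such a coloring exists. $G$ is $4$-$\chi_\rho$-critical if $\chi_\rho(G)=4$ and $\chi_\rho(H)<\chi_\rho(G)$ for every proper subgraph $H$ of $G$. -}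

module Defs where

open import Data.Nat using (ℕ; suc; _+_; _≤_; _<_; z≤n; s≤s)
open import Data.Nat.Properties using (1+n≢n) renaming (_≟_ to _≟ℕ_)
open import Data.Fin using (Fin; zero; suc; toℕ; splitAt)
import Data.Fin.Properties as Fin
open import Data.List using (List; []; _∷_; length; lookup)
open import Data.Product using (Σ; ∃; _×_; _,_)
open import Data.Sum using (_⊎_; inj₁; inj₂; swap)
open import Data.Empty using (⊥)
open import Function.Bundles using (_↔_; _⇔_; Inverse)
open import Function.Definitions using (Injective)
open import Level using (0ℓ)
open import Relation.Binary.Core using (Rel)
open import Relation.Binary.Definitions using (Symmetric; Irreflexive; Decidable)
open import Relation.Binary.PropositionalEquality using (_≡_; _≢_; refl; sym; trans; cong)
open import Relation.Nullary using (¬_; no)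
open import Relation.Nullary.Decidable using (_×-dec_; _⊎-dec_)

record Graph : Set₁ where
  field
    order      : ℕ
    Adj        : Rel (Fin order) 0ℓ
    adj-sym    : Symmetric Adj
    adj-irrefl : Irreflexive _≡_ Adj
    adj?       : Decidable Adj

open Graph public

V : Graph → Set
V G = Fin (order G)

record _≅_ (G H : Graph) : Set where
  field
    bijection : V G ↔ V H
    adj-iff   : ∀ u v → Adj G u v ⇔ Adj H (Inverse.to bijection u) (Inverse.to bijection v)

infix 4 _≅_

data Walk (G : Graph) : V G → V G → ℕ → Set where
  []  : ∀ {u} → Walk G u u 0
  _∷_ : ∀ {u v w n} → Adj G u v → Walk G v w n → Walk G u w (suc n)

IsDistance : (G : Graph) → V G → V G → ℕ → Set
IsDistance G u v d = Walk G u v d × (∀ e → Walk G u v e → d ≤ e)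

-- d(u,v) > i.  Vertices in different components are at no finite distance,
-- so the condition holds for them, in accordance with d(u,v) = ∞.
Distance> : (G : Graph) → V G → V G → ℕ → Set
Distance> G u v i = ∀ d → IsDistance G u v d → i < d

-- The element c u of Fin k encodes the colour suc (toℕ (c u)) ∈ {1,…,k}.
IsPackingColoring : (G : Graph) (k : ℕ) → (V G → Fin k) → Set
IsPackingColoring G k c =
  ∀ u v → u ≢ v → c u ≡ c v → Distance> G u v (suc (toℕ (c u)))

PackingColorable : Graph → ℕ → Set
PackingColorable G k = ∃ λ (c : V G → Fin k) → IsPackingColoring G k c

-- χρ(G) = k.
IsPackingChromaticNumber : Graph → ℕ → Set
IsPackingChromaticNumber G k =
  PackingColorable G k × (∀ j → PackingColorable G j → k ≤ j)

-- A (not necessarily induced or spanning) subgraph of G, presented as a graph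
-- H together with the inclusion of its vertices and edges into those of G.
record Subgraph (G : Graph) : Set₁ where
  field
    graph     : Graph
    inclusion : V graph → V G
    injective : Injective _≡_ _≡_ inclusion
    adj-pres  : ∀ u v → Adj graph u v → Adj G (inclusion u) (inclusion v)

-- Some vertex of G is missing from H, or some edge of G between vertices of H is.
IsProper : {G : Graph} → Subgraph G → Set
IsProper {G} H =
    (∃ λ (v : V G) → ∀ u → inclusion u ≢ v)
  ⊎ (∃ λ u → ∃ λ v → Adj G (inclusion u) (inclusion v) × ¬ Adj graph u v)
  where open Subgraph H

IsCritical : ℕ → Graph → Set₁
IsCritical k G =
    IsPackingChromaticNumber G k
  × (∀ (H : Subgraph G) → IsProper H →
       ∃ λ m → IsPackingChromaticNumber (Subgraph.graph H) m × m < k)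

Next : ∀ {n} → Fin n → Fin n → Set
Next {n} i j = suc (toℕ i) ≡ toℕ j ⊎ (suc (toℕ i) ≡ n × toℕ j ≡ 0)

next? : ∀ {n} → Decidable (Next {n})
next? {n} i j = (suc (toℕ i) ≟ℕ toℕ j) ⊎-dec ((suc (toℕ i) ≟ℕ n) ×-dec (toℕ j ≟ℕ 0))

next-irrefl : ∀ {n} → 3 ≤ n → (i : Fin n) → ¬ Next i i
next-irrefl _ i (inj₁ e) = 1+n≢n e
next-irrefl (s≤s (s≤s _)) i (inj₂ (e , z)) with () ← trans (sym e) (cong suc z)

cycle : (n : ℕ) → 3 ≤ n → Graph
cycle n 3≤n = record
  { order      = n
  ; Adj        = λ i j → Next i j ⊎ Next j i
  ; adj-sym    = swap
  ; adj-irrefl = λ { {i} refl (inj₁ p) → next-irrefl 3≤n i p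
                   ; {i} refl (inj₂ p) → next-irrefl 3≤n i p }
  ; adj?       = λ i j → next? i j ⊎-dec next? j i
  }

module _ (G : Graph) (vs : List (V G)) where

  LeafAdj : Rel (V G ⊎ Fin (length vs)) 0ℓ
  LeafAdj (inj₁ u) (inj₁ v) = Adj G u v
  LeafAdj (inj₁ u) (inj₂ l) = u ≡ lookup vs l
  LeafAdj (inj₂ l) (inj₁ u) = u ≡ lookup vs l
  LeafAdj (inj₂ _) (inj₂ _) = ⊥

  leafAdj-sym : Symmetric LeafAdj
  leafAdj-sym {inj₁ _} {inj₁ _} a = adj-sym G a
  leafAdj-sym {inj₁ _} {inj₂ _} a = a
  leafAdj-sym {inj₂ _} {inj₁ _} a = a

  leafAdj-irrefl : ∀ x → ¬ LeafAdj x x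
  leafAdj-irrefl (inj₁ _) a = adj-irrefl G refl a

  leafAdj? : Decidable LeafAdj
  leafAdj? (inj₁ u) (inj₁ v) = adj? G u v
  leafAdj? (inj₁ u) (inj₂ l) = u Fin.≟ lookup vs l
  leafAdj? (inj₂ l) (inj₁ u) = u Fin.≟ lookup vs l
  leafAdj? (inj₂ _) (inj₂ _) = no λ ()

  -- One new leaf is attached to G for each entry of vs, so the number of leaves
  -- attached to a vertex is its multiplicity in vs.
  attachLeaves : Graph
  attachLeaves = record
    { order      = order G + length vs
    ; Adj        = λ x y → LeafAdj (splitAt (order G) x) (splitAt (order G) y)
    ; adj-sym    = λ {x} {y} → leafAdj-sym {splitAt (order G) x} {splitAt (order G) y}
    ; adj-irrefl = λ { {x} refl → leafAdj-irrefl (splitAt (order G) x) }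
    ; adj?       = λ x y → leafAdj? (splitAt (order G) x) (splitAt (order G) y)
    }

-- The class 𝒞.  Such a graph contains exactly one cycle, since the attached
-- leaves lie on no cycle.
InClassC : Graph → Set
InClassC G = ∃ λ m → Σ (3 ≤ m) λ 3≤m → ∃ λ (vs : List (Fin m)) →
  G ≅ attachLeaves (cycle m 3≤m) vs

C₃ C₄ : Graph
C₃ = cycle 3 (s≤s (s≤s (s≤s z≤n)))
C₄ = cycle 4 (s≤s (s≤s (s≤s z≤n)))

net : Graph
net = attachLeaves C₃ (zero ∷ suc zero ∷ suc (suc zero) ∷ [])

-- The vertices zero and suc zero of C₄ are adjacent.
C₄-with-two-adjacent-leaves : Graph
C₄-with-two-adjacent-leaves = attachLeaves C₄ (zero ∷ suc zero ∷ [])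

{-# OPTIONS --safe #-}
-- A graph without isolated vertices is critical as soon as it is not 3-colourable,
-- it is 4-colourable, and deleting any single edge makes it 3-colourable.
--
-- In a 3-packing colouring a vertex with three neighbours does not have colour 1, and
-- of two consecutive vertices on a path that continues by two vertices on both sides
-- exactly one has colour 1: after the colours 3, 2 there is first a 1 and then no
-- colour left.  Hence colour 1 alternates along a cycle of length at least 5, and 2 and
-- 3 alternate on the other vertices, so a 3-colourable cycle has length divisible by 4.
--
-- For cycle length 4q the pattern 1, 2, 1, 3 extends to the leaves unless leaves are
-- attached to vertices a and b of opposite parity.  If q ≥ 2, one of the two arcs
-- between a and b leaves room for two more vertices at both of its ends, and the
-- alternation of colour 1 along it is contradicted at a and b even after an edge of the
-- other arc is deleted; so no such graph is critical.
module Submission where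

open import Data.Empty using (⊥)
open import Data.Fin using (Fin; zero; suc; toℕ; fromℕ<; splitAt; join; inject≤; _↑ˡ_; _↑ʳ_; finToFun; funToFin; _≟_)
open import Data.Fin.Patterns
open import Data.Fin.Properties using (any?; all?; ¬∀⟶∃¬; toℕ-injective; toℕ<n; toℕ-fromℕ<; toℕ-inject≤; inject≤-injective; finToFun-funToFin; splitAt-↑ˡ; splitAt-↑ʳ; splitAt-join; join-splitAt; ↑ˡ-injective; +↔⊎)
open import Data.List using (List; []; _∷_; length; lookup)
open import Data.List.Relation.Unary.Any as Any using (Any)
open import Data.Nat using (ℕ; zero; suc; _+_; _*_; _∸_; _^_; _/_; _≤_; _<_; z≤n; s≤s; s≤s⁻¹; _≤?_; _<?_)
open import Data.Nat.DivMod using (_%_; m≡m%n+[m/n]*n; m%n<n)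
import Data.Nat.Properties as ℕ
open import Data.Nat.Tactic.RingSolver using (solve-∀)
open import Data.Product using (Σ; ∃; _×_; _,_; proj₁; proj₂)
open import Data.Sum using (_⊎_; inj₁; inj₂; [_,_]′; swap) renaming (map to ⊎-map)
open import Data.Sum.Function.Propositional using (_⊎-↔_)
open import Data.Sum.Properties using (inj₁-injective; inj₂-injective)
open import Data.Vec as Vec using (Vec; []; _∷_)
open import Function.Base using (id; _∘_; const)
open import Function.Bundles using (_⇔_; _↔_; Inverse; Equivalence; mk⇔; mk↔ₛ′)
open import Function.Construct.Composition using (_↔-∘_)
open import Function.Construct.Symmetry using (↔-sym)
open import Function.Definitions using (Injective)
open import Relation.Binary.Definitions using (tri<; tri≈; tri>)
open import Relation.Binary.PropositionalEquality using (_≡_; _≢_; _≗_; refl; sym; trans; cong; subst; subst₂)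
open import Relation.Nullary using (¬_; Dec; yes; no; contradiction)
open import Relation.Nullary.Decidable using (map′; from-yes; ¬?; _×-dec_; _⊎-dec_; _→-dec_; decidable-stable)
open import Defs

-- Decidability of walks, distances and packing colourings.

walk? : ∀ G u v n → Dec (Walk G u v n)
walk? G u v zero    = map′ (λ { refl → [] }) (λ { [] → refl }) (u ≟ v)
walk? G u v (suc n) =
  map′ (λ (w , a , p) → a ∷ p) (λ { (a ∷ p) → _ , a , p })
       (any? λ w → adj? G u w ×-dec walk? G w v n)

-- Serves twice: to pass from a walk to the distance, and from a sufficient number of colours to the
-- chromatic number.
least : ∀ {P : ℕ → Set} → (∀ n → Dec (P n)) → ∀ n → P n →
        ∃ λ m → m ≤ n × P m × (∀ j → P j → m ≤ j)
least P? n p with P? 0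
... | yes p₀ = 0 , z≤n , p₀ , λ _ _ → z≤n
least P? zero    p | no ¬p₀ = contradiction p ¬p₀
least P? (suc n) p | no ¬p₀ with least (P? ∘ suc) n p
... | m , m≤n , pm , min = suc m , s≤s m≤n , pm ,
      λ { zero p₀ → contradiction p₀ ¬p₀ ; (suc j) pj → s≤s (min j pj) }

-- A walk guarantees that the distance exists and is at most its length. Together with the converse
-- below, this turns distance conditions into bounds on arbitrary walks.
distance>⇒walk> : ∀ {G u v i} → Distance> G u v i → ∀ {e} → Walk G u v e → i < e
distance>⇒walk> {G} {u} {v} far {e} w with least (walk? G u v) e w
... | d , d≤e , wd , min = ℕ.<-≤-trans (far d (wd , min)) d≤e

walk>⇒distance> : ∀ {G u v i} → (∀ {e} → Walk G u v e → i < e) → Distance> G u v i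
walk>⇒distance> far d (w , _) = far w

distance>? : ∀ G u v i → Dec (Distance> G u v i)
distance>? G u v i = map′
  (λ none → walk>⇒distance> λ {e} w → ℕ.≰⇒> λ e≤i →
     none (fromℕ< (s≤s e≤i)) (subst (Walk G u v) (sym (toℕ-fromℕ< (s≤s e≤i))) w))
  (λ far e w → ℕ.<⇒≱ (distance>⇒walk> far w) (s≤s⁻¹ (toℕ<n e)))
  (all? λ (e : Fin (suc i)) → ¬? (walk? G u v (toℕ e)))

isPackingColoring? : ∀ G k c → Dec (IsPackingColoring G k c)
isPackingColoring? G k c =
  all? λ u → all? λ v → ¬? (u ≟ v) →-dec ((c u ≟ c v) →-dec distance>? G u v (suc (toℕ (c u))))

-- Decoding an enumerated colouring gives it back only up to pointwise equality, so the property has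
-- to be transported along `_≗_`.
isPackingColoring-resp-≗ : ∀ {G k c c′} → c ≗ c′ → IsPackingColoring G k c → IsPackingColoring G k c′
isPackingColoring-resp-≗ {G} eq pk u v u≢v same =
  subst (λ x → Distance> G u v (suc (toℕ x))) (eq u)
        (pk u v u≢v (trans (eq u) (trans same (sym (eq v)))))

packingColorable? : ∀ G k → Dec (PackingColorable G k)
packingColorable? G k = map′
  (λ (i , pk) → finToFun i , pk)
  (λ (c , pk) → funToFin c , isPackingColoring-resp-≗ {G} (sym ∘ finToFun-funToFin c) pk)
  (any? {n = k ^ order G} λ i → isPackingColoring? G k (finToFun i))

injective⇒isPackingColoring : ∀ {G k c} → Injective _≡_ _≡_ c → IsPackingColoring G k c
injective⇒isPackingColoring inj u v u≢v same = contradiction (inj same) u≢v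

-- Monotonicity in the number of colours and under embeddings.

packingColorable-mono : ∀ {G j k} → j ≤ k → PackingColorable G j → PackingColorable G k
packingColorable-mono {G} j≤k (c , pk) = (λ v → inject≤ (c v) j≤k) , λ u v u≢v same →
  subst (λ t → Distance> G u v (suc t)) (sym (toℕ-inject≤ (c u) j≤k))
        (pk u v u≢v (inject≤-injective j≤k j≤k _ _ same))

walk-map : ∀ {H G} (f : V H → V G) → (∀ u v → Adj H u v → Adj G (f u) (f v)) →
           ∀ {u v n} → Walk H u v n → Walk G (f u) (f v) n
walk-map f pres []      = []
walk-map f pres (a ∷ w) = pres _ _ a ∷ walk-map f pres w

-- Walks map forward along `f`, so the images of two vertices are no farther apart than the vertices
-- themselves, and a colouring can be pulled back.
packingColorable-embed : ∀ {H G k} (f : V H → V G) → Injective _≡_ _≡_ f →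
  (∀ u v → Adj H u v → Adj G (f u) (f v)) → PackingColorable G k → PackingColorable H k
packingColorable-embed f inj pres (c , pk) = c ∘ f , λ u v u≢v same → walk>⇒distance> λ w →
  distance>⇒walk> (pk _ _ (u≢v ∘ inj) same) (walk-map f pres w)

-- Invariance under isomorphism.

≅-sym : ∀ {G H} → G ≅ H → H ≅ G
≅-sym {G} {H} φ = record
  { bijection = ↔-sym bijection
  ; adj-iff = λ u v → mk⇔
      (λ a → Equivalence.from (adj-iff _ _) (subst₂ (Adj H) (sym (strictlyInverseˡ u)) (sym (strictlyInverseˡ v)) a))
      (λ a → subst₂ (Adj H) (strictlyInverseˡ u) (strictlyInverseˡ v) (Equivalence.to (adj-iff _ _) a))
  }
  where open _≅_ φ
        open Inverse bijection using (strictlyInverseˡ)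

≅-trans : ∀ {G H K} → G ≅ H → H ≅ K → G ≅ K
≅-trans φ ψ = record
  { bijection = ψ.bijection ↔-∘ φ.bijection
  ; adj-iff = λ u v → mk⇔
      (Equivalence.to (ψ.adj-iff _ _) ∘ Equivalence.to (φ.adj-iff u v))
      (Equivalence.from (φ.adj-iff u v) ∘ Equivalence.from (ψ.adj-iff _ _))
  }
  where module φ = _≅_ φ
        module ψ = _≅_ ψ

module Iso {G H : Graph} (φ : G ≅ H) where
  open _≅_ φ public
  open Inverse bijection public using (to; from; strictlyInverseˡ; strictlyInverseʳ)

  to-injective : Injective _≡_ _≡_ to
  to-injective e = trans (sym (strictlyInverseʳ _)) (trans (cong from e) (strictlyInverseʳ _))

  adj-to : ∀ u v → Adj G u v → Adj H (to u) (to v)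
  adj-to u v = Equivalence.to (adj-iff u v)

  adj-to⁻ : ∀ u v → Adj H (to u) (to v) → Adj G u v
  adj-to⁻ u v = Equivalence.from (adj-iff u v)

  packingColorable : ∀ {k} → PackingColorable H k → PackingColorable G k
  packingColorable = packingColorable-embed to to-injective adj-to

-- A proper subgraph of `H` becomes one of `G`, with the same underlying graph, once its inclusion
-- is followed by the inverse isomorphism.
isCritical-resp-≅ : ∀ {k G H} → G ≅ H → IsCritical k G → IsCritical k H
isCritical-resp-≅ {k} {G} {H} φ ((col , min) , sub) =
  (ψ.packingColorable col , λ j → min j ∘ φ.packingColorable) , λ K → sub (pull K) ∘ pull-proper K
  where
    module φ = Iso φ
    module ψ = Iso (≅-sym φ)
    pull : Subgraph H → Subgraph G
    pull K = record
      { graph = graph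
      ; inclusion = ψ.to ∘ inclusion
      ; injective = injective ∘ ψ.to-injective
      ; adj-pres = λ u v → ψ.adj-to _ _ ∘ adj-pres u v
      } where open Subgraph K
    pull-proper : ∀ K → IsProper K → IsProper (pull K)
    pull-proper K (inj₁ (v , missing))   = inj₁ (ψ.to v , λ u → missing u ∘ ψ.to-injective)
    pull-proper K (inj₂ (u , v , a , ¬a)) = inj₂ (u , v , ψ.adj-to _ _ a , ¬a)

-- Criticality by deletion of single edges.

SameEdge : ∀ {A : Set} → A → A → A → A → Set
SameEdge a b x y = (x ≡ a × y ≡ b) ⊎ (x ≡ b × y ≡ a)

sameEdge-swap : ∀ {A : Set} {a b x y : A} → SameEdge a b x y → SameEdge a b y x
sameEdge-swap (inj₁ (p , q)) = inj₂ (q , p)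
sameEdge-swap (inj₂ (p , q)) = inj₁ (q , p)

deleteEdge : (G : Graph) → V G → V G → Graph
deleteEdge G a b = record
  { order      = order G
  ; Adj        = λ x y → Adj G x y × ¬ SameEdge a b x y
  ; adj-sym    = λ (p , ¬e) → adj-sym G p , ¬e ∘ sameEdge-swap
  ; adj-irrefl = λ e (p , _) → adj-irrefl G e p
  ; adj?       = λ x y → adj? G x y ×-dec
                   ¬? (((x ≟ a) ×-dec (y ≟ b)) ⊎-dec ((x ≟ b) ×-dec (y ≟ a)))
  }

deletedSubgraph : ∀ G → V G → V G → Subgraph G
deletedSubgraph G a b = record
  { graph = deleteEdge G a b ; inclusion = id ; injective = id ; adj-pres = λ _ _ → proj₁ }

isCritical⇒¬packingColorable : ∀ {k G} → IsCritical (suc k) G → ¬ PackingColorable G k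
isCritical⇒¬packingColorable ((_ , min) , _) col = ℕ.1+n≰n (min _ col)

isCritical⇒deleteEdge : ∀ {k G} → IsCritical (suc k) G → ∀ {a b} → Adj G a b →
                        PackingColorable (deleteEdge G a b) k
isCritical⇒deleteEdge {k} {G} (_ , sub) {a} {b} ab
  with m , (col , _) , m<k ← sub (deletedSubgraph G a b) (inj₂ (a , b , ab , λ (_ , ¬e) → ¬e (inj₁ (refl , refl))))
  = packingColorable-mono {deleteEdge G a b} (s≤s⁻¹ m<k) col

-- Every proper subgraph avoids some edge of `G`: the missing edge itself, or any edge at a missing
-- vertex, which exists as no vertex is isolated. It therefore embeds into `G` without that edge.
deleteEdge⇒isCritical : ∀ {k G} → PackingColorable G (suc k) → ¬ PackingColorable G k →
  (∀ v → ∃ λ w → Adj G v w) → (∀ a b → Adj G a b → PackingColorable (deleteEdge G a b) k) →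
  IsCritical (suc k) G
deleteEdge⇒isCritical {k} {G} col ¬col noIsolated del =
  (col , λ j colj → ℕ.≰⇒> λ j≤k → ¬col (packingColorable-mono {G} j≤k colj)) , proper
  where
    within : ∀ (H : Subgraph G) a b → Adj G a b →
             (∀ u v → Adj (Subgraph.graph H) u v → ¬ SameEdge a b (Subgraph.inclusion H u) (Subgraph.inclusion H v)) →
             PackingColorable (Subgraph.graph H) k
    within H a b ab avoids = packingColorable-embed {G = deleteEdge G a b} inclusion injective
      (λ u v uv → adj-pres u v uv , avoids u v uv) (del a b ab)
      where open Subgraph H

    colored : ∀ (H : Subgraph G) → IsProper H → PackingColorable (Subgraph.graph H) k
    colored H (inj₁ (v , missing)) with w , vw ← noIsolated v =
      within H v w vw λ { x y _ (inj₁ (e , _)) → missing x e ; x y _ (inj₂ (_ , e)) → missing y e }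
    colored H (inj₂ (u , v , uv , ¬uv)) =
      within H _ _ uv λ { x y xy (inj₁ (p , q)) → ¬uv (subst₂ (Adj graph) (injective p) (injective q) xy)
                        ; x y xy (inj₂ (p , q)) → ¬uv (adj-sym graph (subst₂ (Adj graph) (injective p) (injective q) xy)) }
      where open Subgraph H

    proper : ∀ (H : Subgraph G) → IsProper H → ∃ λ m → IsPackingChromaticNumber (Subgraph.graph H) m × m < suc k
    proper H p with m , m≤k , colm , min ← least (packingColorable? (Subgraph.graph H)) k (colored H p) =
      m , (colm , min) , s≤s m≤k

-- Colourings and embeddings of graphs with attached leaves.

module Attach (G : Graph) (vs : List (V G)) where

  node : V G → V (attachLeaves G vs)
  node u = u ↑ˡ length vs

  leaf : Fin (length vs) → V (attachLeaves G vs)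
  leaf l = order G ↑ʳ l

  node-injective : Injective _≡_ _≡_ node
  node-injective = ↑ˡ-injective (length vs) _ _

  node≢leaf : ∀ {u l} → node u ≢ leaf l
  node≢leaf {u} {l} e
    with () ← trans (sym (splitAt-↑ˡ (order G) u (length vs)))
                    (trans (cong (splitAt (order G)) e) (splitAt-↑ʳ (order G) (length vs) l))

  node-adj : ∀ {u v} → Adj G u v → Adj (attachLeaves G vs) (node u) (node v)
  node-adj {u} {v} a
    rewrite splitAt-↑ˡ (order G) u (length vs) | splitAt-↑ˡ (order G) v (length vs) = a

  leaf-adj : ∀ {u} l → u ≡ lookup vs l → Adj (attachLeaves G vs) (node u) (leaf l)
  leaf-adj {u} l e
    rewrite splitAt-↑ˡ (order G) u (length vs) | splitAt-↑ʳ (order G) (length vs) l = e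

  splitAt-injective : Injective _≡_ _≡_ (splitAt (order G) {length vs})
  splitAt-injective e = trans (sym (join-splitAt (order G) (length vs) _))
    (trans (cong (join (order G) (length vs)) e) (join-splitAt (order G) (length vs) _))

  -- The retraction onto `G` along the leaf edges.
  base : V G ⊎ Fin (length vs) → V G
  base = [ id , lookup vs ]′

  base-adj : ∀ s t → LeafAdj G vs s t → base s ≡ base t ⊎ Adj G (base s) (base t)
  base-adj (inj₁ u) (inj₁ v) a = inj₂ a
  base-adj (inj₁ u) (inj₂ l) a = inj₁ a
  base-adj (inj₂ l) (inj₁ u) a = inj₁ (sym a)

  -- Leaf edges collapse under the retraction, so attaching leaves brings no two vertices of `G`
  -- closer together.
  base-walk : ∀ {x y d} → Walk (attachLeaves G vs) x y d →
    ∃ λ e → e ≤ d × Walk G (base (splitAt (order G) x)) (base (splitAt (order G) y)) e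
  base-walk [] = 0 , z≤n , []
  base-walk {x} {y} (a ∷ w)
    with e , e≤d , w′ ← base-walk w | base-adj (splitAt (order G) x) _ a
  ... | inj₁ eq = e , ℕ.m≤n⇒m≤1+n e≤d , subst (λ z → Walk G z _ e) (sym eq) w′
  ... | inj₂ a′ = suc e , s≤s e≤d , a′ ∷ w′

  -- All leaves receive colour 1. They are pairwise non-adjacent and their only neighbours have
  -- other colours, so distance 2 is ensured.
  extendColoring : ∀ {k} (c : V G → Fin (suc k)) → IsPackingColoring G (suc k) c →
    (∀ l → c (lookup vs l) ≢ zero) → PackingColorable (attachLeaves G vs) (suc k)
  extendColoring {k} c pk nonzero = color ∘ splitAt (order G) , packing
    where
      color : V G ⊎ Fin (length vs) → Fin (suc k)
      color = [ c , const zero ]′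

      ¬adj : ∀ s t → color s ≡ zero → color t ≡ zero →
             (∃ λ l → s ≡ inj₂ l) ⊎ (∃ λ l → t ≡ inj₂ l) → ¬ LeafAdj G vs s t
      ¬adj (inj₁ u) (inj₂ l) p q _ refl = nonzero l p
      ¬adj (inj₂ l) (inj₁ u) p q _ refl = nonzero l q
      ¬adj (inj₁ _) (inj₁ _) _ _ (inj₁ (_ , ()))
      ¬adj (inj₁ _) (inj₁ _) _ _ (inj₂ (_ , ()))

      far₁ : ∀ {x y} → x ≢ y →
        color (splitAt (order G) x) ≡ zero → color (splitAt (order G) y) ≡ zero →
        (∃ λ l → splitAt (order G) x ≡ inj₂ l) ⊎ (∃ λ l → splitAt (order G) y ≡ inj₂ l) →
        ∀ {d} → Walk (attachLeaves G vs) x y d → 1 < d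
      far₁ x≢y p q r []          = contradiction refl x≢y
      far₁ {x} {y} x≢y p q r (a ∷ []) =
        contradiction a (¬adj (splitAt (order G) x) (splitAt (order G) y) p q r)
      far₁ x≢y p q r (_ ∷ _ ∷ _) = s≤s (s≤s z≤n)

      packing : IsPackingColoring (attachLeaves G vs) (suc k) (color ∘ splitAt (order G))
      packing x y x≢y same = walk>⇒distance> (cases (splitAt (order G) x) (splitAt (order G) y) refl refl same)
        where
          cases : ∀ s t → splitAt (order G) x ≡ s → splitAt (order G) y ≡ t → color s ≡ color t →
                  ∀ {d} → Walk (attachLeaves G vs) x y d → suc (toℕ (color (splitAt (order G) x))) < d
          cases (inj₁ u) (inj₁ v) p q same w with e , e≤d , w′ ← base-walk w rewrite p | q =
            ℕ.<-≤-trans (distance>⇒walk> (pk u v (λ { refl → x≢y (splitAt-injective (trans p (sym q))) }) same) w′) e≤d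
          cases (inj₁ u) (inj₂ l) p q same w =
            subst (λ t → suc (toℕ t) < _) (sym (trans (cong color p) same)) (far₁ x≢y (trans (cong color p) same) (cong color q) (inj₂ (l , q)) w)
          cases (inj₂ l) t p q same w =
            subst (λ t → suc (toℕ t) < _) (sym (cong color p)) (far₁ x≢y (cong color p) (trans (cong color q) (sym same)) (inj₁ (l , p)) w)

-- `σ` selects leaves of the larger graph, in any order and among any multiplicities, so that a
-- known graph that is not colourable is found inside it.
module AttachMap {H G : Graph} (φ : H ≅ G) (ws : List (V H)) (vs : List (V G))
  (σ : Fin (length ws) → Fin (length vs)) (σ-injective : Injective _≡_ _≡_ σ)
  (σ-lookup : ∀ l → lookup vs (σ l) ≡ Inverse.to (_≅_.bijection φ) (lookup ws l)) where

  private
    module φ = Iso φ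
    module A = Attach G vs
    module B = Attach H ws

  split-map : V H ⊎ Fin (length ws) → V G ⊎ Fin (length vs)
  split-map = ⊎-map φ.to σ

  split-map-injective : Injective _≡_ _≡_ split-map
  split-map-injective {inj₁ _} {inj₁ _} e = cong inj₁ (φ.to-injective (inj₁-injective e))
  split-map-injective {inj₂ _} {inj₂ _} e = cong inj₂ (σ-injective (inj₂-injective e))

  split-map-adj : ∀ s t → LeafAdj H ws s t → LeafAdj G vs (split-map s) (split-map t)
  split-map-adj (inj₁ u) (inj₁ v) a    = φ.adj-to u v a
  split-map-adj (inj₁ u) (inj₂ l) refl = sym (σ-lookup l)
  split-map-adj (inj₂ l) (inj₁ u) refl = sym (σ-lookup l)

  split-map-adj⁻ : ∀ s t → LeafAdj G vs (split-map s) (split-map t) → LeafAdj H ws s t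
  split-map-adj⁻ (inj₁ u) (inj₁ v) a = φ.adj-to⁻ u v a
  split-map-adj⁻ (inj₁ u) (inj₂ l) a = φ.to-injective (trans a (σ-lookup l))
  split-map-adj⁻ (inj₂ l) (inj₁ u) a = φ.to-injective (trans a (σ-lookup l))

  embed : V (attachLeaves H ws) → V (attachLeaves G vs)
  embed x = join (order G) (length vs) (split-map (splitAt (order H) x))

  splitAt-embed : ∀ x → splitAt (order G) (embed x) ≡ split-map (splitAt (order H) x)
  splitAt-embed x = splitAt-join (order G) (length vs) _

  embed-injective : Injective _≡_ _≡_ embed
  embed-injective {x} {y} e = B.splitAt-injective (split-map-injective
    (trans (sym (splitAt-embed x)) (trans (cong (splitAt (order G)) e) (splitAt-embed y))))

  embed-adj : ∀ x y → Adj (attachLeaves H ws) x y → Adj (attachLeaves G vs) (embed x) (embed y)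
  embed-adj x y a = subst₂ (LeafAdj G vs) (sym (splitAt-embed x)) (sym (splitAt-embed y))
    (split-map-adj (splitAt (order H) x) (splitAt (order H) y) a)

  embed-adj⁻ : ∀ x y → Adj (attachLeaves G vs) (embed x) (embed y) → Adj (attachLeaves H ws) x y
  embed-adj⁻ x y a = split-map-adj⁻ (splitAt (order H) x) (splitAt (order H) y)
    (subst₂ (LeafAdj G vs) (splitAt-embed x) (splitAt-embed y) a)

  embed≢leaf : ∀ {l} → (∀ l′ → σ l′ ≢ l) → ∀ x → embed x ≢ A.leaf l
  embed≢leaf {l} missed x e = go (splitAt (order H) x)
    (trans (sym (splitAt-embed x)) (trans (cong (splitAt (order G)) e) (splitAt-↑ʳ (order G) (length vs) l)))
    where
      go : ∀ s → split-map s ≢ inj₂ l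
      go (inj₂ l′) e = missed l′ (inj₂-injective e)

  surjective⇒≅ : (∀ l → ∃ λ l′ → σ l′ ≡ l) → attachLeaves H ws ≅ attachLeaves G vs
  surjective⇒≅ surj = record
    { bijection = ↔-sym +↔⊎ ↔-∘ ((φ.bijection ⊎-↔ σ-↔) ↔-∘ +↔⊎)
    ; adj-iff = λ x y → mk⇔ (embed-adj x y) (embed-adj⁻ x y)
    }
    where
      σ-↔ : Fin (length ws) ↔ Fin (length vs)
      σ-↔ = mk↔ₛ′ σ (proj₁ ∘ surj) (proj₂ ∘ surj) (λ l → σ-injective (proj₂ (surj (σ l))))

  -- A leaf outside the image of σ could be cut off without making the graph k-colourable.
  isCritical⇒≅ : ∀ {k} → IsCritical (suc k) (attachLeaves G vs) →
                 ¬ PackingColorable (attachLeaves H ws) k → attachLeaves H ws ≅ attachLeaves G vs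
  isCritical⇒≅ critical ¬col = surjective⇒≅ λ l → decidable-stable (any? λ l′ → σ l′ ≟ l) λ missed →
    let avoid = embed≢leaf (λ l′ e → missed (l′ , e)) in
    ¬col (packingColorable-embed {G = deleteEdge (attachLeaves G vs) (A.node (lookup vs l)) (A.leaf l)} embed embed-injective
      (λ x y a → embed-adj x y a , λ { (inj₁ (_ , e)) → avoid y e ; (inj₂ (e , _)) → avoid x e })
      (isCritical⇒deleteEdge critical (A.leaf-adj l refl)))

≅-refl : ∀ {G} → G ≅ G
≅-refl = record { bijection = mk↔ₛ′ id id (λ _ → refl) (λ _ → refl) ; adj-iff = λ _ _ → mk⇔ id id }

-- The order `order G + 0` does not reduce to `order G`, so an isomorphism takes the place of an
-- equality.
attachLeaves-[] : ∀ G → attachLeaves G [] ≅ G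
attachLeaves-[] G = record
  { bijection = mk↔ₛ′ (A.base ∘ splitAt (order G)) A.node
      (λ u → cong A.base (splitAt-↑ˡ (order G) u 0))
      (λ x → A.splitAt-injective (trans (splitAt-↑ˡ (order G) _ 0) (inj₁-base (splitAt (order G) x))))
  ; adj-iff = λ x y → adj-base (splitAt (order G) x) (splitAt (order G) y)
  }
  where
    module A = Attach G []
    inj₁-base : ∀ s → inj₁ (A.base s) ≡ s
    inj₁-base (inj₁ _) = refl
    adj-base : ∀ s t → LeafAdj G [] s t ⇔ Adj G (A.base s) (A.base t)
    adj-base (inj₁ _) (inj₁ _) = mk⇔ id id

-- The periodic pattern 1, 2, 1, 3.

1213-coloring : ℕ → Fin 3
1213-coloring 0 = zero
1213-coloring 1 = 1F
1213-coloring 2 = zero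
1213-coloring 3 = 2F
1213-coloring (suc (suc (suc (suc i)))) = 1213-coloring i

1213-periodic : ∀ q i → 1213-coloring (q * 4 + i) ≡ 1213-coloring i
1213-periodic zero    i = refl
1213-periodic (suc q) i = 1213-periodic q i

-- Colour 1 recurs after 2 steps, colours 2 and 3 after 4. The bound is the colour plus one, the
-- least distance that a packing colouring allows.
1213-gap : ∀ i j → i < j → 1213-coloring i ≡ 1213-coloring j → 2 + toℕ (1213-coloring i) + i ≤ j
1213-gap 0 (suc (suc j)) _ e = s≤s (s≤s z≤n)
1213-gap 1 (suc (suc (suc (suc j)))) _ e = s≤s (s≤s (s≤s (s≤s z≤n)))
1213-gap 1 0 ()
1213-gap 1 1 (s≤s ())
1213-gap 2 (suc (suc (suc (suc j)))) _ e = s≤s (s≤s (s≤s (s≤s z≤n)))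
1213-gap 2 1 (s≤s ())
1213-gap 2 2 (s≤s (s≤s ()))
1213-gap 3 (suc (suc (suc (suc (suc (suc (suc j))))))) _ e = s≤s (s≤s (s≤s (s≤s (s≤s (s≤s (s≤s z≤n))))))
1213-gap 3 1 (s≤s ())
1213-gap 3 2 (s≤s (s≤s ()))
1213-gap 3 3 (s≤s (s≤s (s≤s ())))
1213-gap (suc (suc (suc (suc i)))) (suc (suc (suc (suc j)))) (s≤s (s≤s (s≤s (s≤s i<j)))) e =
  subst (_≤ 4 + j) (cong (2 +_) (sym (comm (toℕ (1213-coloring i))))) (ℕ.+-monoʳ-≤ 4 (1213-gap i j i<j e))
  where
    comm : ∀ t → t + (4 + i) ≡ 4 + (t + i)
    comm t = trans (sym (ℕ.+-assoc t 4 i)) (trans (cong (_+ i) (ℕ.+-comm t 4)) (ℕ.+-assoc 4 t i))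
1213-gap (suc (suc (suc (suc i)))) 1 (s≤s ())
1213-gap (suc (suc (suc (suc i)))) 2 (s≤s (s≤s ()))
1213-gap (suc (suc (suc (suc i)))) 3 (s≤s (s≤s (s≤s ())))

1213-far : ∀ {i j d} → i < j → 1213-coloring i ≡ 1213-coloring j → j ≤ d + i → suc (toℕ (1213-coloring i)) < d
1213-far {i} {j} {d} i<j same j≤d+i = ℕ.+-cancelʳ-≤ i _ d (ℕ.≤-trans (1213-gap i j i<j same) j≤d+i)

1213-far′ : ∀ {i j d} → j < i → 1213-coloring i ≡ 1213-coloring j → i ≤ d + j → suc (toℕ (1213-coloring i)) < d
1213-far′ {d = d} j<i same i≤d+j =
  subst (λ x → suc (toℕ x) < d) (sym same) (1213-far j<i (sym same) i≤d+j)

1213-zero-+2 : ∀ i → 1213-coloring (2 + i) ≡ zero → 1213-coloring i ≡ zero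
1213-zero-+2 0 e = refl
1213-zero-+2 2 e = refl
1213-zero-+2 (suc (suc (suc (suc i)))) e = 1213-zero-+2 i e

1213-zero-+2⁻ : ∀ i → 1213-coloring i ≡ zero → 1213-coloring (2 + i) ≡ zero
1213-zero-+2⁻ 0 e = refl
1213-zero-+2⁻ 2 e = refl
1213-zero-+2⁻ (suc (suc (suc (suc i)))) e = 1213-zero-+2⁻ i e

1213-zero-suc : ∀ i → 1213-coloring i ≡ zero → 1213-coloring (suc i) ≢ zero
1213-zero-suc 0 _ ()
1213-zero-suc 2 _ ()
1213-zero-suc (suc (suc (suc (suc i)))) e e′ = 1213-zero-suc i e e′

module _ {G : Graph} (p : V G → ℕ) (adj-step : ∀ {u v} → Adj G u v → p v ≤ suc (p u)) where

  walk-step : ∀ {u v d} → Walk G u v d → p v ≤ d + p u × p u ≤ d + p v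
  walk-step [] = ℕ.≤-refl , ℕ.≤-refl
  walk-step {u} {v} {suc d} (a ∷ w) with q , r ← walk-step w =
    ℕ.≤-trans q (ℕ.≤-trans (ℕ.+-monoʳ-≤ d (adj-step a)) (ℕ.≤-reflexive (ℕ.+-suc d (p u)))) ,
    ℕ.≤-trans (adj-step (adj-sym G a)) (s≤s r)

  -- Positions change by at most one along each edge, so distances are at least the differences of
  -- positions, and the pattern works as on a path.
  positions⇒packingColorable : Injective _≡_ _≡_ p → PackingColorable G 3
  positions⇒packingColorable p-injective = 1213-coloring ∘ p , λ u v u≢v same → walk>⇒distance> (far u≢v same)
    where
      far : ∀ {u v d} → u ≢ v → 1213-coloring (p u) ≡ 1213-coloring (p v) → Walk G u v d →
            suc (toℕ (1213-coloring (p u))) < d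
      far {u} {v} u≢v same w with ℕ.<-cmp (p u) (p v)
      ... | tri< lt _ _ = 1213-far lt same (proj₁ (walk-step w))
      ... | tri≈ _ eq _ = contradiction (p-injective eq) u≢v
      ... | tri> _ _ gt = 1213-far′ gt same (proj₂ (walk-step w))

-- Distances and colourings on a cycle and on a cut cycle.

module _ {n : ℕ} (3≤n : 3 ≤ n) where

  -- Cyclic distance at most `d`, written without subtraction: the difference of `i` and `j` is at
  -- most `d`, or at least `n` minus `d`.
  CycleDistance≤ : ℕ → ℕ → ℕ → Set
  CycleDistance≤ d i j = (i ≤ d + j × j ≤ d + i) ⊎ n + i ≤ d + j ⊎ n + j ≤ d + i

  cycleDistance-next : ∀ {d j} {x x′ : Fin n} → j < n → Next x x′ →
    CycleDistance≤ d (toℕ x′) j → CycleDistance≤ (suc d) (toℕ x) j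
  cycleDistance-next {d} {j} {x} {x′} j<n (inj₁ e) c rewrite sym e | ℕ.+-suc d (toℕ x) | ℕ.+-suc n (toℕ x) = go c
    where
      go : (suc (toℕ x) ≤ d + j × j ≤ suc (d + toℕ x)) ⊎ suc (n + toℕ x) ≤ d + j ⊎ n + j ≤ suc (d + toℕ x) →
           CycleDistance≤ (suc d) (toℕ x) j
      go (inj₁ (p , q)) = inj₁ (ℕ.≤-trans (ℕ.n≤1+n _) (ℕ.m≤n⇒m≤1+n p) , q)
      go (inj₂ (inj₁ p)) = inj₂ (inj₁ (ℕ.≤-trans (ℕ.n≤1+n _) (ℕ.m≤n⇒m≤1+n p)))
      go (inj₂ (inj₂ p)) = inj₂ (inj₂ p)
  cycleDistance-next {d} {j} {x} {x′} j<n (inj₂ (e , e₀)) c rewrite e₀ | ℕ.+-identityʳ d | ℕ.+-identityʳ n = go c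
    where
      wrap : j ≤ d → n + j ≤ suc d + toℕ x
      wrap j≤d = ℕ.≤-trans (ℕ.+-mono-≤ (ℕ.≤-reflexive (sym e)) j≤d) (ℕ.≤-reflexive (cong suc (ℕ.+-comm (toℕ x) d)))
      go : (0 ≤ d + j × j ≤ d) ⊎ n ≤ d + j ⊎ n + j ≤ d → CycleDistance≤ (suc d) (toℕ x) j
      go (inj₁ (_ , q)) = inj₂ (inj₂ (wrap q))
      go (inj₂ (inj₁ p)) = inj₁ (ℕ.≤-trans (ℕ.<⇒≤ (toℕ<n x)) (ℕ.m≤n⇒m≤1+n p) ,
        ℕ.≤-trans (s≤s⁻¹ (ℕ.≤-trans j<n (ℕ.≤-reflexive (sym e)))) (ℕ.m≤n+m (toℕ x) (suc d)))
      go (inj₂ (inj₂ p)) = inj₂ (inj₂ (wrap (ℕ.≤-trans (ℕ.m≤n+m j n) p)))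

  cycleDistance-prev : ∀ {d j} {x x′ : Fin n} → j < n → Next x′ x →
    CycleDistance≤ d (toℕ x′) j → CycleDistance≤ (suc d) (toℕ x) j
  cycleDistance-prev {d} {j} {x} {x′} j<n (inj₁ e) c rewrite sym e | ℕ.+-suc d (toℕ x′) | ℕ.+-suc n (toℕ x′) = go c
    where
      go : (toℕ x′ ≤ d + j × j ≤ d + toℕ x′) ⊎ n + toℕ x′ ≤ d + j ⊎ n + j ≤ d + toℕ x′ →
           (suc (toℕ x′) ≤ suc d + j × j ≤ suc (suc (d + toℕ x′))) ⊎ suc (n + toℕ x′) ≤ suc d + j ⊎ n + j ≤ suc (suc (d + toℕ x′))
      go (inj₁ (p , q)) = inj₁ (s≤s p , ℕ.m≤n⇒m≤1+n (ℕ.m≤n⇒m≤1+n q))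
      go (inj₂ (inj₁ p)) = inj₂ (inj₁ (s≤s p))
      go (inj₂ (inj₂ p)) = inj₂ (inj₂ (ℕ.m≤n⇒m≤1+n (ℕ.m≤n⇒m≤1+n p)))
  cycleDistance-prev {d} {j} {x} {x′} j<n (inj₂ (e , e₀)) c rewrite e₀ | ℕ.+-identityʳ d | ℕ.+-identityʳ n = go c
    where
      n≤ : ∀ {k} → toℕ x′ ≤ k → n ≤ suc k
      n≤ le = ℕ.≤-trans (ℕ.≤-reflexive (sym e)) (s≤s le)
      small : n + j ≤ d + toℕ x′ → j ≤ suc d
      small p = ℕ.m≤n⇒m≤1+n (ℕ.+-cancelʳ-≤ (toℕ x′) j d (ℕ.≤-trans (ℕ.+-monoʳ-≤ j (ℕ.<⇒≤ (toℕ<n x′))) (ℕ.≤-trans (ℕ.≤-reflexive (ℕ.+-comm j n)) p)))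
      go : (toℕ x′ ≤ d + j × j ≤ d + toℕ x′) ⊎ n + toℕ x′ ≤ d + j ⊎ n + j ≤ d + toℕ x′ →
           (0 ≤ suc d + j × j ≤ suc d) ⊎ n ≤ suc d + j ⊎ n + j ≤ suc d
      go (inj₁ (p , q)) = inj₂ (inj₁ (n≤ p))
      go (inj₂ (inj₁ p)) = inj₂ (inj₁ (ℕ.m≤n⇒m≤1+n (ℕ.≤-trans (ℕ.m≤m+n n _) p)))
      go (inj₂ (inj₂ p)) = inj₁ (z≤n , small p)

  cycleDistance : ∀ {x y d} → Walk (cycle n 3≤n) x y d → CycleDistance≤ d (toℕ x) (toℕ y)
  cycleDistance [] = inj₁ (ℕ.≤-refl , ℕ.≤-refl)
  cycleDistance {y = y} (inj₁ a ∷ w) = cycleDistance-next (toℕ<n y) a (cycleDistance w)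
  cycleDistance {y = y} (inj₂ a ∷ w) = cycleDistance-prev (toℕ<n y) a (cycleDistance w)

  -- Since 4 divides `n`, adding `n` to a position keeps its colour, and a walk through the
  -- wrap-around is judged like one on a line. The shift `s` decides which parity class receives
  -- colour 1.
  4∣n⇒isPackingColoring : ∀ q → n ≡ q * 4 → ∀ s →
    IsPackingColoring (cycle n 3≤n) 3 (λ x → 1213-coloring (s + toℕ x))
  4∣n⇒isPackingColoring q n≡ s x y x≢y same = walk>⇒distance> λ w → far (cycleDistance w)
    where
      +-swap : ∀ a b c → a + (b + c) ≡ b + (a + c)
      +-swap a b c = trans (sym (ℕ.+-assoc a b c)) (trans (cong (_+ c) (ℕ.+-comm a b)) (ℕ.+-assoc b a c))
      shift : ∀ d {i j} → i ≤ d + j → s + i ≤ d + (s + j)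
      shift d {i} {j} le = ℕ.≤-trans (ℕ.+-monoʳ-≤ s le) (ℕ.≤-reflexive (+-swap s d j))
      shiftₙ : ∀ d {i j} → n + i ≤ d + j → n + (s + i) ≤ d + (s + j)
      shiftₙ d {i} {j} le = ℕ.≤-trans (ℕ.≤-reflexive (+-swap n s i)) (shift d le)
      periodic : ∀ i → 1213-coloring (n + i) ≡ 1213-coloring i
      periodic i = trans (cong (λ m → 1213-coloring (m + i)) n≡) (1213-periodic q i)
      below : ∀ (u : Fin n) v → s + toℕ u < n + (s + v)
      below u v = ℕ.<-≤-trans (ℕ.+-monoʳ-< s (toℕ<n u)) (ℕ.≤-trans (ℕ.+-monoʳ-≤ s (ℕ.m≤m+n n v)) (ℕ.≤-reflexive (+-swap s n v)))
      far : ∀ {d} → CycleDistance≤ d (toℕ x) (toℕ y) → suc (toℕ (1213-coloring (s + toℕ x))) < d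
      far {d} (inj₁ (p , q)) with ℕ.<-cmp (toℕ x) (toℕ y)
      ... | tri< lt _ _ = 1213-far (ℕ.+-monoʳ-< s lt) same (shift d q)
      ... | tri≈ _ eq _ = contradiction (toℕ-injective eq) x≢y
      ... | tri> _ _ gt = 1213-far′ (ℕ.+-monoʳ-< s gt) same (shift d p)
      far {d} (inj₂ (inj₁ p)) = subst (λ c → suc (toℕ c) < d) (periodic _)
        (1213-far′ (below y (toℕ x)) (trans (periodic _) same) (shiftₙ d p))
      far {d} (inj₂ (inj₂ p)) =
        1213-far (below x (toℕ y)) (trans same (sym (periodic _))) (shiftₙ d p)


  fourColor : ∀ (x : Fin n) → Dec (suc (toℕ x) ≡ n) → Fin 4
  fourColor x (yes _) = suc 2F
  fourColor x (no _)  = inject≤ (1213-coloring (toℕ x)) (ℕ.n≤1+n 3)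

  -- Colour 4 on the last vertex separates the two ends of the pattern.
  cycle-4-colorable : PackingColorable (cycle n 3≤n) 4
  cycle-4-colorable = (λ x → fourColor x (last? x)) , λ x y x≢y same →
    walk>⇒distance> λ w → far x≢y (last? x) (last? y) same (cycleDistance w)
    where
      last? : ∀ (x : Fin n) → Dec (suc (toℕ x) ≡ n)
      last? x = suc (toℕ x) ℕ.≟ n

      inject≤-≢-4 : ∀ (c : Fin 3) → inject≤ c (ℕ.n≤1+n 3) ≢ suc 2F
      inject≤-≢-4 zero ()
      inject≤-≢-4 1F ()
      inject≤-≢-4 2F ()

      color≤position : ∀ i → toℕ (1213-coloring i) ≤ i
      color≤position 0 = z≤n
      color≤position 1 = s≤s z≤n
      color≤position 2 = z≤n
      color≤position 3 = s≤s (s≤s z≤n)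
      color≤position (suc (suc (suc (suc i)))) = ℕ.m≤n⇒m≤o+n 4 (color≤position i)

      -- As `j` is not the last vertex, going past that vertex to `i` takes at least `2 + i` steps,
      -- more than the colour at `i`.
      wrap : ∀ {d i j} → j < n → suc j ≢ n → n + i ≤ d + j → suc (toℕ (1213-coloring i)) < d
      wrap {d} {i} {j} j<n j≢ le = ℕ.+-cancelʳ-≤ j _ d (begin
        2 + toℕ (1213-coloring i) + j ≤⟨ ℕ.+-monoˡ-≤ j (ℕ.+-monoʳ-≤ 2 (color≤position i)) ⟩
        2 + i + j                     ≡⟨ ℕ.+-comm (2 + i) j ⟩
        j + (2 + i)                   ≡⟨ sym (ℕ.+-assoc j 2 i) ⟩
        j + 2 + i                     ≡⟨ cong (_+ i) (ℕ.+-comm j 2) ⟩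
        2 + j + i                     ≤⟨ ℕ.+-monoˡ-≤ i (ℕ.≤∧≢⇒< j<n j≢) ⟩
        n + i                         ≤⟨ le ⟩
        d + j                         ∎)
        where open ℕ.≤-Reasoning

      far : ∀ {x y d} → x ≢ y → (x? : Dec (suc (toℕ x) ≡ n)) (y? : Dec (suc (toℕ y) ≡ n)) →
            fourColor x x? ≡ fourColor y y? → CycleDistance≤ d (toℕ x) (toℕ y) → suc (toℕ (fourColor x x?)) < d
      far x≢y (yes p) (yes q) _ _ = contradiction (toℕ-injective (ℕ.suc-injective (trans p (sym q)))) x≢y
      far {y = y} x≢y (yes p) (no q) same _ = contradiction (sym same) (inject≤-≢-4 (1213-coloring (toℕ y)))
      far {x} x≢y (no p) (yes q) same _ = contradiction same (inject≤-≢-4 (1213-coloring (toℕ x)))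
      far {x} {y} {d} x≢y (no p) (no q) same₄ cd =
        subst (λ t → suc t < d) (sym (toℕ-inject≤ (1213-coloring (toℕ x)) (ℕ.n≤1+n 3))) (near cd)
        where
          same : 1213-coloring (toℕ x) ≡ 1213-coloring (toℕ y)
          same = inject≤-injective (ℕ.n≤1+n 3) (ℕ.n≤1+n 3) _ _ same₄
          near : CycleDistance≤ d (toℕ x) (toℕ y) → suc (toℕ (1213-coloring (toℕ x))) < d
          near (inj₁ (r , s)) with ℕ.<-cmp (toℕ x) (toℕ y)
          ... | tri< lt _ _ = 1213-far lt same s
          ... | tri≈ _ eq _ = contradiction (toℕ-injective eq) x≢y
          ... | tri> _ _ gt = 1213-far′ gt same r
          near (inj₂ (inj₁ r)) = wrap (toℕ<n y) q r
          near (inj₂ (inj₂ r)) = subst (λ c → suc (toℕ c) < d) (sym same) (wrap (toℕ<n x) p r)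

  module CutCycle {r s : Fin n} (rs : Next r s) where

    -- The number of `Next` steps from `s` to `x`: 0 at `s` and `n` minus 1 at `r`. The relational
    -- form avoids truncated subtraction.
    Position : Fin n → ℕ → Set
    Position x p = (toℕ s ≤ toℕ x × p + toℕ s ≡ toℕ x) ⊎ (toℕ x < toℕ s × p + toℕ s ≡ toℕ x + n)

    position : ∀ x → ∃ (Position x)
    position x with toℕ s ≤? toℕ x
    ... | yes le = toℕ x ∸ toℕ s , inj₁ (le , ℕ.m∸n+n≡m le)
    ... | no  gt = toℕ x + n ∸ toℕ s , inj₂ (ℕ.≰⇒> gt ,
                     ℕ.m∸n+n≡m (ℕ.≤-trans (ℕ.<⇒≤ (toℕ<n s)) (ℕ.m≤n+m n (toℕ x))))

    position-unique : ∀ {x y p} → Position x p → Position y p → x ≡ y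
    position-unique (inj₁ (_ , e)) (inj₁ (_ , e′)) = toℕ-injective (trans (sym e) e′)
    position-unique {x} {y} (inj₁ (_ , e)) (inj₂ (_ , e′)) =
      contradiction (ℕ.≤-trans (ℕ.m≤n+m n (toℕ y)) (ℕ.≤-reflexive (trans (sym e′) e))) (ℕ.<⇒≱ (toℕ<n x))
    position-unique {x} {y} (inj₂ (_ , e)) (inj₁ (_ , e′)) =
      contradiction (ℕ.≤-trans (ℕ.m≤n+m n (toℕ x)) (ℕ.≤-reflexive (trans (sym e) e′))) (ℕ.<⇒≱ (toℕ<n y))
    position-unique (inj₂ (_ , e)) (inj₂ (_ , e′)) =
      toℕ-injective (ℕ.+-cancelʳ-≡ n _ _ (trans (sym e) e′))

    -- The position drops only on the step from `r` to `s`, so cutting that edge leaves a path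
    -- numbered in order.
    next-position : ∀ {x y p p′} → Next x y → ¬ (x ≡ r × y ≡ s) → Position x p → Position y p′ → p′ ≡ suc p
    next-position (inj₁ e) _ (inj₁ (_ , f)) (inj₁ (_ , f′)) =
      ℕ.+-cancelʳ-≡ (toℕ s) _ _ (trans f′ (trans (sym e) (cong suc (sym f))))
    next-position (inj₁ e) _ (inj₂ (_ , f)) (inj₂ (_ , f′)) =
      ℕ.+-cancelʳ-≡ (toℕ s) _ _ (trans f′ (trans (cong (_+ n) (sym e)) (cong suc (sym f))))
    next-position (inj₁ e) _ (inj₁ (le , _)) (inj₂ (gt , _)) =
      contradiction (ℕ.≤-trans le (ℕ.≤-trans (ℕ.n≤1+n _) (ℕ.≤-reflexive e))) (ℕ.<⇒≱ gt)
    next-position {x} {y} (inj₁ e) cut (inj₂ (gt , _)) (inj₁ (le , _)) = contradiction (r≡ rs , toℕ-injective y≡s) cut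
      where
        y≡s : toℕ y ≡ toℕ s
        y≡s = ℕ.≤-antisym (ℕ.≤-trans (ℕ.≤-reflexive (sym e)) gt) le
        r≡ : Next r s → x ≡ r
        r≡ (inj₁ e′) = toℕ-injective (ℕ.suc-injective (trans e (trans y≡s (sym e′))))
        r≡ (inj₂ (_ , e₀)) = contradiction (subst (toℕ x <_) e₀ gt) λ ()
    next-position {x} {y} (inj₂ (e , e₀)) cut _ (inj₁ (le , _)) = contradiction (r≡ rs , toℕ-injective (trans e₀ (sym s≡0))) cut
      where
        s≡0 : toℕ s ≡ 0
        s≡0 = ℕ.n≤0⇒n≡0 (subst (toℕ s ≤_) e₀ le)
        r≡ : Next r s → x ≡ r
        r≡ (inj₁ e′) with () ← trans e′ s≡0
        r≡ (inj₂ (e′ , _)) = toℕ-injective (ℕ.suc-injective (trans e (sym e′)))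
    next-position (inj₂ (e , e₀)) _ (inj₁ (_ , f)) (inj₂ (_ , f′)) =
      ℕ.+-cancelʳ-≡ (toℕ s) _ _ (trans f′ (trans (cong (_+ n) e₀) (trans (sym e) (cong suc (sym f)))))
    next-position (inj₂ (e , _)) _ (inj₂ (gt , _)) _ =
      contradiction (ℕ.≤-trans (ℕ.≤-reflexive (sym e)) gt) (ℕ.<⇒≱ (toℕ<n s))

    cutCycle-3-colorable : PackingColorable (deleteEdge (cycle n 3≤n) r s) 3
    cutCycle-3-colorable = positions⇒packingColorable (proj₁ ∘ position) step
      (λ {x} {y} e → position-unique (proj₂ (position x)) (subst (Position y) (sym e) (proj₂ (position y))))
      where
        step : ∀ {u v} → Adj (deleteEdge (cycle n 3≤n) r s) u v → proj₁ (position v) ≤ suc (proj₁ (position u))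
        step {u} {v} (inj₁ a , ¬e) = ℕ.≤-reflexive (next-position a (¬e ∘ inj₁) (proj₂ (position u)) (proj₂ (position v)))
        step {u} {v} (inj₂ a , ¬e) = ℕ.≤-trans (ℕ.n≤1+n _) (ℕ.≤-trans
          (ℕ.≤-reflexive (sym (next-position a (λ (p , q) → ¬e (inj₂ (q , p))) (proj₂ (position v)) (proj₂ (position u))))) (ℕ.n≤1+n _))

  deleteEdge-cycle-3-colorable : ∀ a b → Adj (cycle n 3≤n) a b → PackingColorable (deleteEdge (cycle n 3≤n) a b) 3
  deleteEdge-cycle-3-colorable a b (inj₁ ab) = CutCycle.cutCycle-3-colorable ab
  deleteEdge-cycle-3-colorable a b (inj₂ ba) =
    packingColorable-embed {deleteEdge (cycle n 3≤n) a b} {deleteEdge (cycle n 3≤n) b a} id id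
      (λ _ _ (p , ¬e) → p , ¬e ∘ swap) (CutCycle.cutCycle-3-colorable ba)

-- Constraints on 3-packing colourings along paths.

other-nonzero : ∀ {a b : Fin 3} → a ≢ zero → b ≢ zero → a ≢ b → (a ≡ 1F × b ≡ 2F) ⊎ (a ≡ 2F × b ≡ 1F)
other-nonzero {zero} p q r = contradiction refl p
other-nonzero {1F} {zero} p q r = contradiction refl q
other-nonzero {1F} {1F} p q r = contradiction refl r
other-nonzero {1F} {2F} p q r = inj₁ (refl , refl)
other-nonzero {2F} {zero} p q r = contradiction refl q
other-nonzero {2F} {1F} p q r = inj₂ (refl , refl)
other-nonzero {2F} {2F} p q r = contradiction refl r

≢1∧≢2⇒zero : ∀ {a : Fin 3} → a ≢ 1F → a ≢ 2F → a ≡ zero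
≢1∧≢2⇒zero {zero} p q = refl
≢1∧≢2⇒zero {1F} p q = contradiction refl p
≢1∧≢2⇒zero {2F} p q = contradiction refl q

-- Pigeonhole: only colours 2 and 3 are available.
no-three-nonzero : ∀ {a b c : Fin 3} → a ≢ zero → b ≢ zero → c ≢ zero → a ≢ b → a ≢ c → b ≢ c → ⊥
no-three-nonzero a₀ b₀ c₀ ab ac bc with other-nonzero a₀ b₀ ab | other-nonzero a₀ c₀ ac
... | inj₁ (_ , refl) | inj₁ (_ , refl) = bc refl
... | inj₂ (_ , refl) | inj₂ (_ , refl) = bc refl
... | inj₁ (refl , _) | inj₂ (() , _)
... | inj₂ (refl , _) | inj₁ (() , _)

module ThreeColoring (G : Graph) (c : V G → Fin 3) (packing : IsPackingColoring G 3 c) where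

  adj⇒≢ : ∀ {x y} → Adj G x y → c x ≢ c y
  adj⇒≢ xy same with distance>⇒walk> (packing _ _ (λ e → adj-irrefl G e xy) same) (xy ∷ [])
  ... | s≤s ()

  two-apart : ∀ {x y z} → x ≢ z → Adj G x y → Adj G y z → c x ≢ zero → c x ≢ c z
  two-apart {x} x≢z xy yz nonzero same with c x | distance>⇒walk> (packing _ _ x≢z same) (xy ∷ yz ∷ [])
  ... | zero  | _ = nonzero refl
  ... | suc _ | s≤s (s≤s ())

  three-apart : ∀ {x y z w} → x ≢ w → Adj G x y → Adj G y z → Adj G z w → c x ≡ 2F → c w ≢ 2F
  three-apart {x} x≢w xy yz zw cx cw
    with c x | cx | distance>⇒walk> (packing _ _ x≢w (trans cx (sym cw))) (xy ∷ yz ∷ zw ∷ [])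
  ... | _ | refl | s≤s (s≤s (s≤s ()))

  -- If `u` had colour 1, its three neighbours, pairwise at distance at most 2, would need three
  -- different colours among 2 and 3.
  branch⇒nonzero : ∀ {u x y z} → Adj G u x → Adj G u y → Adj G u z → x ≢ y → x ≢ z → y ≢ z → c u ≢ zero
  branch⇒nonzero {u} ux uy uz x≢y x≢z y≢z cu =
    no-three-nonzero (n ux) (n uy) (n uz)
      (two-apart x≢y (adj-sym G ux) uy (n ux)) (two-apart x≢z (adj-sym G ux) uz (n ux))
      (two-apart y≢z (adj-sym G uy) uz (n uy))
    where
      n : ∀ {x} → Adj G u x → c x ≢ zero
      n ux cx = adj⇒≢ ux (trans cu (sym cx))

  -- Both `x₀` and `x₁` are too close to `x₂` for colour 2 and to `x₃` for colour 3. Both would have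
  -- colour 1, but they are adjacent.
  ¬23-after-two : ∀ {x₀ x₁ x₂ x₃} → Adj G x₀ x₁ → Adj G x₁ x₂ → Adj G x₂ x₃ → x₀ ≢ x₂ → x₁ ≢ x₃ → x₀ ≢ x₃ →
                  ¬ (c x₂ ≡ 1F × c x₃ ≡ 2F)
  ¬23-after-two {x₀} {x₁} a₀₁ a₁₂ a₂₃ n₀₂ n₁₃ n₀₃ (c₂ , c₃) = adj⇒≢ a₀₁ (trans zero₀ (sym zero₁))
    where
      zero₁ : c x₁ ≡ zero
      zero₁ = ≢1∧≢2⇒zero (λ e → adj⇒≢ a₁₂ (trans e (sym c₂)))
        (λ e → two-apart n₁₃ a₁₂ a₂₃ (λ e₀ → contradiction (trans (sym e) e₀) λ ()) (trans e (sym c₃)))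
      zero₀ : c x₀ ≡ zero
      zero₀ = ≢1∧≢2⇒zero
        (λ e → two-apart n₀₂ a₀₁ a₁₂ (λ e₀ → contradiction (trans (sym e) e₀) λ ()) (trans e (sym c₂)))
        (λ e → three-apart n₀₃ a₀₁ a₁₂ a₂₃ e c₃)

  -- Only vertices two or three steps apart are required to differ, so `f` may wind around a cycle.
  -- Adjacency is asked for below `N` only, which lets an edge beyond that be deleted.
  module Path (f : ℕ → V G) (N : ℕ) (f-adj : ∀ i → i < N → Adj G (f i) (f (suc i)))
              (f-2 : ∀ i → f i ≢ f (2 + i)) (f-3 : ∀ i → f i ≢ f (3 + i)) where

    -- Two consecutive inner vertices have exactly one of colour 1: colours 2, 3 in
    -- this order leave no colour for the second vertex before them.
    nonzero⇒zero : ∀ i → 5 + i ≤ N → c (f (2 + i)) ≢ zero → c (f (3 + i)) ≡ zero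
    nonzero⇒zero i le n₂ with c (f (3 + i)) ≟ zero
    ... | yes z = z
    ... | no n₃ with other-nonzero n₂ n₃ (adj⇒≢ (f-adj (2 + i) (ℕ.≤-trans (ℕ.+-monoˡ-≤ i {3} {5} (s≤s (s≤s (s≤s z≤n)))) le)))
    ...   | inj₁ e = contradiction e (¬23-after-two
              (f-adj i (ℕ.≤-trans (ℕ.+-monoˡ-≤ i {1} {5} (s≤s z≤n)) le))
              (f-adj (1 + i) (ℕ.≤-trans (ℕ.+-monoˡ-≤ i {2} {5} (s≤s (s≤s z≤n))) le))
              (f-adj (2 + i) (ℕ.≤-trans (ℕ.+-monoˡ-≤ i {3} {5} (s≤s (s≤s (s≤s z≤n)))) le))
              (f-2 i) (f-2 (1 + i)) (f-3 i))
    -- The opposite order of colours is the same situation on the reversed path.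
    ...   | inj₂ (e , e′) = contradiction (e′ , e) (¬23-after-two
              (adj-sym G (f-adj (4 + i) le))
              (adj-sym G (f-adj (3 + i) (ℕ.≤-trans (ℕ.n≤1+n _) le)))
              (adj-sym G (f-adj (2 + i) (ℕ.≤-trans (ℕ.n≤1+n _) (ℕ.≤-trans (ℕ.n≤1+n _) le))))
              (f-2 (3 + i) ∘ sym) (f-2 (2 + i) ∘ sym) (f-3 (2 + i) ∘ sym))

    nonzero⇒nonzero : ∀ i → 5 + i ≤ N → c (f (2 + i)) ≢ zero → c (f (4 + i)) ≢ zero
    nonzero⇒nonzero i le n₂ z₄ =
      adj⇒≢ (f-adj (3 + i) (ℕ.≤-trans (ℕ.n≤1+n _) le)) (trans (nonzero⇒zero i le n₂) (sym z₄))

    even-nonzero : ∀ k → 3 + k * 2 ≤ N → c (f 2) ≢ zero → c (f (2 + k * 2)) ≢ zero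
    even-nonzero zero    _  n₂ = n₂
    even-nonzero (suc k) le n₂ =
      nonzero⇒nonzero (k * 2) le (even-nonzero k (ℕ.≤-trans (ℕ.n≤1+n _) (ℕ.≤-trans (ℕ.n≤1+n _) le)) n₂)

    odd-zero : ∀ k → 5 + k * 2 ≤ N → c (f 2) ≢ zero → c (f (3 + k * 2)) ≡ zero
    odd-zero k le n₂ = nonzero⇒zero (k * 2) le
      (even-nonzero k (ℕ.≤-trans (ℕ.n≤1+n _) (ℕ.≤-trans (ℕ.n≤1+n _) le)) n₂)

  module Line (f : ℕ → V G) (f-adj : ∀ i → Adj G (f i) (f (suc i)))
              (f-2 : ∀ i → f i ≢ f (2 + i)) (f-3 : ∀ i → f i ≢ f (3 + i)) where

    nonzero⇒zero : ∀ i → c (f (2 + i)) ≢ zero → c (f (3 + i)) ≡ zero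
    nonzero⇒zero i = Path.nonzero⇒zero f (5 + i) (λ j _ → f-adj j) f-2 f-3 i ℕ.≤-refl

    nonzero⇒nonzero : ∀ i → c (f (2 + i)) ≢ zero → c (f (4 + i)) ≢ zero
    nonzero⇒nonzero i = Path.nonzero⇒nonzero f (5 + i) (λ j _ → f-adj j) f-2 f-3 i ℕ.≤-refl

    nonzero-alternates : ∀ i → c (f (2 + i)) ≢ zero → c (f (2 + i)) ≢ c (f (4 + i))
    nonzero-alternates i = two-apart (f-2 (2 + i)) (f-adj _) (f-adj _)

    -- Every second vertex has colour 2 or 3, and consecutive ones of these are two steps apart, so
    -- the two colours alternate.
    4-periodic : ∀ q → c (f 2) ≢ zero → c (f (2 + q * 4)) ≡ c (f 2)
    4-periodic zero    n₂ = refl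
    4-periodic (suc q) n₂ = trans (two-steps (q * 4) (n₂ ∘ trans (sym IH))) IH
      where
        IH : c (f (2 + q * 4)) ≡ c (f 2)
        IH = 4-periodic q n₂
        two-steps : ∀ i → c (f (2 + i)) ≢ zero → c (f (6 + i)) ≡ c (f (2 + i))
        two-steps i n = decidable-stable (_ ≟ _) λ ne →
          no-three-nonzero n n₄ n₆ (nonzero-alternates i n) (ne ∘ sym) (nonzero-alternates (2 + i) n₄)
          where n₄ = nonzero⇒nonzero i n
                n₆ = nonzero⇒nonzero (2 + i) n₄

    -- Write `n` as `r + q * 4`. Position `2 + n` is `f 2` again and lies `r` steps after position
    -- `2 + q * 4`, which has the same colour. For odd `r` it would have colour 1 instead, for `r`
    -- equal to 2 the other one of the colours 2 and 3.
    period⇒4∣ : ∀ n → (∀ i → f (n + i) ≡ f i) → c (f 2) ≢ zero → n % 4 ≡ 0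
    period⇒4∣ n period n₂ = go (n % 4) (n / 4) (m%n<n n 4) (m≡m%n+[m/n]*n n 4)
      where
        back : ∀ {m} → n ≡ m → f (2 + m) ≡ f 2
        back refl = trans (cong f (ℕ.+-comm 2 n)) (period 2)
        go : ∀ r q → r < 4 → n ≡ r + q * 4 → r ≡ 0
        go 0 q _ e = refl
        go 1 q _ e = contradiction (trans (cong c (sym (back e))) (nonzero⇒zero (q * 4) (n₂ ∘ trans (sym (4-periodic q n₂))))) n₂
        go 2 q _ e = contradiction (trans (4-periodic q n₂) (cong c (sym (back e))))
          (nonzero-alternates (q * 4) (n₂ ∘ trans (sym (4-periodic q n₂))))
        go 3 q _ e = contradiction (trans (cong c (sym (back e)))
          (nonzero⇒zero (2 + q * 4) (nonzero⇒nonzero (q * 4) (n₂ ∘ trans (sym (4-periodic q n₂)))))) n₂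
        go (suc (suc (suc (suc r)))) q (s≤s (s≤s (s≤s (s≤s ())))) e

-- Walking around a cycle.

successor : ∀ {n} (i : Fin n) → ∃ (Next i)
successor {suc n} i with suc (toℕ i) <? suc n
... | yes lt = fromℕ< lt , inj₁ (sym (toℕ-fromℕ< lt))
... | no ¬lt = zero , inj₂ (ℕ.≤-antisym (toℕ<n i) (ℕ.≮⇒≥ ¬lt) , refl)

orbit : ∀ {n} → Fin n → ℕ → Fin n
orbit s zero    = s
orbit s (suc i) = proj₁ (successor (orbit s i))

orbit-next : ∀ {n} (s : Fin n) i → Next (orbit s i) (orbit s (suc i))
orbit-next s i = proj₂ (successor (orbit s i))

module Orbit {n : ℕ} (f : ℕ → Fin n) (f-next : ∀ i → Next (f i) (f (suc i))) where

  -- Up to `n` steps pass the wrap-around at most once: a second passage would put the start at `n`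
  -- or beyond.
  advance : ∀ k i → k ≤ n → toℕ (f (k + i)) ≡ k + toℕ (f i) ⊎ n + toℕ (f (k + i)) ≡ k + toℕ (f i)
  advance zero    i _ = inj₁ refl
  advance (suc k) i k<n with advance k i (ℕ.<⇒≤ k<n) | f-next (k + i)
  ... | inj₁ e | inj₁ g       = inj₁ (trans (sym g) (cong suc e))
  ... | inj₁ e | inj₂ (g , z) =
    inj₂ (trans (cong (n +_) z) (trans (ℕ.+-identityʳ n) (trans (sym g) (cong suc e))))
  ... | inj₂ e | inj₁ g       =
    inj₂ (trans (cong (n +_) (sym g)) (trans (ℕ.+-suc n _) (cong suc e)))
  ... | inj₂ e | inj₂ (g , _) = contradiction
    (ℕ.+-cancelˡ-≤ k _ _ (begin
      k + n                  ≡⟨ ℕ.+-comm k n ⟩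
      n + k                  ≤⟨ ℕ.+-monoʳ-≤ n (s≤s⁻¹ (ℕ.≤-trans k<n (ℕ.≤-reflexive (sym g)))) ⟩
      n + toℕ (f (k + i))    ≡⟨ e ⟩
      k + toℕ (f i)          ∎))
    (ℕ.<⇒≱ (toℕ<n (f i)))
    where open ℕ.≤-Reasoning

  reach : ∀ {b} k i → k ≤ n → k + toℕ (f i) ≡ toℕ b ⊎ k + toℕ (f i) ≡ n + toℕ b → f (k + i) ≡ b
  reach {b} k i k≤n target with advance k i k≤n | target
  ... | inj₁ e | inj₁ g = toℕ-injective (trans e g)
  ... | inj₂ e | inj₂ g = toℕ-injective (ℕ.+-cancelˡ-≡ n _ _ (trans e g))
  ... | inj₁ e | inj₂ g = contradiction (ℕ.≤-trans (ℕ.m≤m+n n _) (ℕ.≤-reflexive (sym (trans e g)))) (ℕ.<⇒≱ (toℕ<n (f (k + i))))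
  ... | inj₂ e | inj₁ g = contradiction (ℕ.≤-trans (ℕ.m≤m+n n _) (ℕ.≤-reflexive (trans e g))) (ℕ.<⇒≱ (toℕ<n b))

  period : ∀ i → f (n + i) ≡ f i
  period i = reach n i ℕ.≤-refl (inj₂ refl)

  distinct : ∀ k i → 0 < k → k < n → f i ≢ f (k + i)
  distinct k i 0<k k<n same with advance k i (ℕ.<⇒≤ k<n)
  ... | inj₁ e = ℕ.<⇒≢ 0<k (ℕ.+-cancelʳ-≡ (toℕ (f i)) 0 k (trans (cong toℕ same) e))
  ... | inj₂ e = ℕ.<⇒≢ k<n (sym (ℕ.+-cancelʳ-≡ (toℕ (f i)) n k (trans (cong (λ x → n + toℕ x) same) e)))

-- Obstructions to 3-colourability on cycles.

cycle-¬3-colorable : ∀ {n} (3≤n : 3 ≤ n) → 5 ≤ n → n % 4 ≢ 0 → ¬ PackingColorable (cycle n 3≤n) 3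
cycle-¬3-colorable {suc n} 3≤n 5≤n n%4≢0 (c , packing) = n%4≢0 (go (c (f 2) ≟ zero))
  where
    f : ℕ → Fin (suc n)
    f = orbit zero
    open ThreeColoring (cycle (suc n) 3≤n) c packing
    open Orbit f (orbit-next zero)
    f-2 : ∀ i → f i ≢ f (2 + i)
    f-2 i = distinct 2 i (s≤s z≤n) 3≤n
    f-3 : ∀ i → f i ≢ f (3 + i)
    f-3 i = distinct 3 i (s≤s z≤n) (ℕ.<⇒≤ 5≤n)
    f-adj : ∀ i → Adj (cycle (suc n) 3≤n) (f i) (f (suc i))
    f-adj i = inj₁ (orbit-next zero i)
    go : Dec (c (f 2) ≡ zero) → suc n % 4 ≡ 0
    go (no n₂)  = Line.period⇒4∣ f f-adj f-2 f-3 (suc n) period n₂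
    -- If position 2 has colour 1, position 3 does not, and the argument starts one step later.
    go (yes z₂) = Line.period⇒4∣ (f ∘ suc) (f-adj ∘ suc) (f-2 ∘ suc) (f-3 ∘ suc) (suc n)
      (λ i → trans (cong f (sym (ℕ.+-suc (suc n) i))) (period (suc i)))
      (λ z₃ → adj⇒≢ (f-adj 2) (trans z₂ (sym z₃)))

-- An edge of the cycle far from both branch vertices is deleted; the resulting tree is
-- still not 3-colourable, as colour 1 would have to alternate between them.
odd-leaf-distance⇒¬isCritical : ∀ {n} (3≤n : 3 ≤ n) (vs : List (Fin n)) (l l′ : Fin (length vs)) k → 6 + k * 2 ≤ n →
  (let a = toℕ (lookup vs l) ; b = toℕ (lookup vs l′) in 1 + k * 2 + a ≡ b ⊎ 1 + k * 2 + a ≡ n + b) →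
  ¬ IsCritical 4 (attachLeaves (cycle n 3≤n) vs)
odd-leaf-distance⇒¬isCritical {1} (s≤s ())
odd-leaf-distance⇒¬isCritical {suc (suc n)} 3≤n vs l l′ k 6+2k≤n target critical = uncolorable coloring
  where
    a b : Fin (2 + n)
    a = lookup vs l
    b = lookup vs l′
    A : Graph
    A = attachLeaves (cycle (2 + n) 3≤n) vs
    open Attach (cycle (2 + n) 3≤n) vs

    f : ℕ → Fin (2 + n)
    -- The cycle has length `2 + n`, so this walk starts two steps before `a`. That puts `a` at
    -- position 2 and `b` at `3 + k * 2`, with two further vertices beyond each.
    f i = orbit a (i + n)
    f-next : ∀ i → Next (f i) (f (suc i))
    f-next i = orbit-next a (i + n)
    open Orbit f f-next

    f2≡a : f 2 ≡ a
    f2≡a = trans (cong (orbit a) (sym (ℕ.+-identityʳ (2 + n)))) (Orbit.period (orbit a) (orbit-next a) 0)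

    f3+2k≡b : f (3 + k * 2) ≡ b
    f3+2k≡b = trans (cong f (cong suc (ℕ.+-comm 2 (k * 2)))) (reach (1 + k * 2) 2
      (ℕ.≤-trans (ℕ.+-monoˡ-≤ (k * 2) {1} {6} (s≤s z≤n)) 6+2k≤n)
      (subst (λ x → 1 + k * 2 + toℕ x ≡ toℕ b ⊎ 1 + k * 2 + toℕ x ≡ 2 + n + toℕ b) (sym f2≡a) target))

    H : Graph
    -- The edge that closes the walk is removed. As `6 + k * 2` is at most the length, it is not
    -- among the first `5 + k * 2` edges.
    H = deleteEdge A (node (f (1 + n))) (node (f 0))

    coloring : PackingColorable H 3
    coloring = isCritical⇒deleteEdge critical
      (node-adj (inj₁ (subst (Next (f (1 + n))) (trans (cong f (sym (ℕ.+-identityʳ (2 + n)))) (period 0)) (f-next (1 + n)))))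

    f≢f0 : ∀ i → 0 < i → i < 2 + n → f i ≢ f 0
    f≢f0 i 0<i i<n e = distinct i 0 0<i i<n (trans (sym e) (cong f (sym (ℕ.+-identityʳ i))))

    2<n : 2 < 2 + n
    2<n = 3≤n

    f-adj : ∀ i → i < 5 + k * 2 → Adj H (node (f i)) (node (f (suc i)))
    f-adj i i<5+2k = node-adj (inj₁ (f-next i)) , λ
      { (inj₁ (_ , e)) → f≢f0 (suc i) (s≤s z≤n) (ℕ.≤-trans (s≤s i<5+2k) 6+2k≤n) (node-injective e)
      ; (inj₂ (e , e′)) → not-first i i<5+2k (node-injective e) (node-injective e′) }
      where
        4≤n : 4 ≤ n
        4≤n = s≤s⁻¹ (s≤s⁻¹ (ℕ.≤-trans (ℕ.m≤m+n 6 (k * 2)) 6+2k≤n))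
        not-first : ∀ i → i < 5 + k * 2 → f i ≡ f 0 → f (suc i) ≢ f (1 + n)
        not-first zero    _  _ e = distinct n 1 (ℕ.≤-trans (s≤s z≤n) 4≤n) (ℕ.n≤1+n _) (trans e (cong f (ℕ.+-comm 1 n)))
        not-first (suc i) lt e _ = f≢f0 (suc i) (s≤s z≤n) (ℕ.≤-trans lt (ℕ.≤-trans (ℕ.n≤1+n _) 6+2k≤n)) e

    uncolorable : ¬ PackingColorable H 3
    uncolorable (c , packing) = branch-nonzero (2 + k * 2) l′ (ℕ.n≤1+n _) f3+2k≡b
      (Path.odd-zero (node ∘ f) (5 + k * 2) f-adj f-2 f-3 k ℕ.≤-refl (branch-nonzero 1 l (s≤s (s≤s (s≤s z≤n))) f2≡a))
      where
        open ThreeColoring H c packing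
        f-2 : ∀ i → node (f i) ≢ node (f (2 + i))
        f-2 i = distinct 2 i (s≤s z≤n) 2<n ∘ node-injective
        f-3 : ∀ i → node (f i) ≢ node (f (3 + i))
        f-3 i = distinct 3 i (s≤s z≤n) (ℕ.≤-trans (s≤s (s≤s (s≤s (s≤s z≤n)))) (ℕ.≤-trans (ℕ.m≤m+n 6 (k * 2)) 6+2k≤n)) ∘ node-injective
        branch-nonzero : ∀ i j → 2 + i ≤ 5 + k * 2 → f (1 + i) ≡ lookup vs j → c (node (f (1 + i))) ≢ zero
        branch-nonzero i j i< e = branch⇒nonzero
          (adj-sym H (f-adj i (ℕ.<⇒≤ i<))) (f-adj (1 + i) i<)
          (leaf-adj j e , λ { (inj₁ (_ , e′)) → node≢leaf (sym e′) ; (inj₂ (_ , e′)) → node≢leaf (sym e′) })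
          (f-2 i) node≢leaf node≢leaf

-- The two sporadic critical graphs.

-- A short list of certificates, checked by evaluation, replaces a search through all colourings for
-- every deleted edge.
deleteEdge-colorings : (G : Graph) → List (Vec (Fin 3) (order G)) → Set
deleteEdge-colorings G cs = ∀ a b → Adj G a b → Any (λ c → IsPackingColoring (deleteEdge G a b) 3 (Vec.lookup c)) cs

deleteEdge-colorings? : ∀ G cs → Dec (deleteEdge-colorings G cs)
deleteEdge-colorings? G cs = all? λ a → all? λ b → adj? G a b →-dec
  Any.any? (λ c → isPackingColoring? (deleteEdge G a b) 3 (Vec.lookup c)) cs

deleteEdge-colorings⇒colorable : ∀ {G cs} → deleteEdge-colorings G cs →
  ∀ a b → Adj G a b → PackingColorable (deleteEdge G a b) 3
deleteEdge-colorings⇒colorable h a b ab with c , packing ← Any.satisfied (h a b ab) = Vec.lookup c , packing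

-- Each triangle vertex has three neighbours and so avoids colour 1, which leaves two colours for a
-- triangle.
net-¬3-colorable : ¬ PackingColorable net 3
net-¬3-colorable (c , packing) = no-three-nonzero nonzero₀ nonzero₁ nonzero₂ (adj⇒≢ a₀₁) (adj⇒≢ a₀₂) (adj⇒≢ a₁₂)
  where
    open ThreeColoring net c packing
    a₀₁ : Adj net 0F 1F
    a₀₁ = inj₁ (inj₁ refl)
    a₁₂ : Adj net 1F 2F
    a₁₂ = inj₁ (inj₁ refl)
    a₀₂ : Adj net 0F 2F
    a₀₂ = inj₂ (inj₂ (refl , refl))
    nonzero₀ : c 0F ≢ 0F
    nonzero₀ = branch⇒nonzero {x = 1F} {2F} {3F} a₀₁ a₀₂ refl (λ ()) (λ ()) (λ ())
    nonzero₁ : c 1F ≢ 0F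
    nonzero₁ = branch⇒nonzero {x = 0F} {2F} {4F} a₀₁′ a₁₂ refl (λ ()) (λ ()) (λ ())
      where a₀₁′ = adj-sym net {0F} {1F} a₀₁
    nonzero₂ : c 2F ≢ 0F
    nonzero₂ = branch⇒nonzero {x = 0F} {1F} {5F} (adj-sym net {0F} {2F} a₀₂) (adj-sym net {1F} {2F} a₁₂) refl (λ ()) (λ ()) (λ ())

net-isCritical : IsCritical 4 net
net-isCritical = deleteEdge⇒isCritical
  (Attach.extendColoring C₃ _ suc (injective⇒isPackingColoring {C₃} λ { refl → refl }) (λ _ ()))
  net-¬3-colorable
  (from-yes (all? λ v → any? λ w → adj? net v w))
  (deleteEdge-colorings⇒colorable {net} {colorings} (from-yes (deleteEdge-colorings? net colorings)))
  where
    colorings : List (Vec (Fin 3) 6)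
    -- In each colouring one triangle vertex and its leaf have colours 1 and 2. It serves when the
    -- edge to that leaf is deleted, or the triangle edge to the vertex of colour 2.
    colorings = (0F ∷ 1F ∷ 2F ∷ 1F ∷ 0F ∷ 0F ∷ [])
              ∷ (1F ∷ 2F ∷ 0F ∷ 0F ∷ 0F ∷ 1F ∷ [])
              ∷ (2F ∷ 0F ∷ 1F ∷ 0F ∷ 1F ∷ 0F ∷ []) ∷ []

-- The vertices with leaves take colours 2 and 3. The other two lie within distance 2 of both, so
-- both would have colour 1, but they are adjacent.
C₄-with-two-adjacent-leaves-¬3-colorable : ¬ PackingColorable C₄-with-two-adjacent-leaves 3
C₄-with-two-adjacent-leaves-¬3-colorable (c , packing) = adj⇒≢ a₂₃ (trans zero₂ (sym zero₃))
  where
    open ThreeColoring C₄-with-two-adjacent-leaves c packing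
    a₀₁ : Adj C₄-with-two-adjacent-leaves 0F 1F
    a₀₁ = inj₁ (inj₁ refl)
    a₁₀ : Adj C₄-with-two-adjacent-leaves 1F 0F
    a₁₀ = inj₂ (inj₁ refl)
    a₁₂ : Adj C₄-with-two-adjacent-leaves 1F 2F
    a₁₂ = inj₁ (inj₁ refl)
    a₂₃ : Adj C₄-with-two-adjacent-leaves 2F 3F
    a₂₃ = inj₁ (inj₁ refl)
    a₀₃ : Adj C₄-with-two-adjacent-leaves 0F 3F
    a₀₃ = inj₂ (inj₂ (refl , refl))
    nonzero₀ : c 0F ≢ 0F
    nonzero₀ = branch⇒nonzero {x = 1F} {3F} {4F} a₀₁ a₀₃ refl (λ ()) (λ ()) (λ ())
    nonzero₁ : c 1F ≢ 0F
    nonzero₁ = branch⇒nonzero {x = 0F} {2F} {5F} a₁₀ a₁₂ refl (λ ()) (λ ()) (λ ())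
    zero₂ : c 2F ≡ 0F
    zero₂ = decidable-stable (_ ≟ _) λ nonzero₂ → no-three-nonzero nonzero₀ nonzero₁ nonzero₂
      (adj⇒≢ a₀₁) (two-apart {y = 1F} (λ ()) a₀₁ a₁₂ nonzero₀) (adj⇒≢ a₁₂)
    zero₃ : c 3F ≡ 0F
    zero₃ = decidable-stable (_ ≟ _) λ nonzero₃ → no-three-nonzero nonzero₀ nonzero₁ nonzero₃
      (adj⇒≢ a₀₁) (adj⇒≢ a₀₃) (two-apart {y = 0F} (λ ()) a₁₀ a₀₃ nonzero₁)

C₄-with-two-adjacent-leaves-isCritical : IsCritical 4 C₄-with-two-adjacent-leaves
C₄-with-two-adjacent-leaves-isCritical = deleteEdge⇒isCritical
  (Attach.extendColoring C₄ _ (Vec.lookup (1F ∷ 2F ∷ 0F ∷ 3F ∷ []))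
    (from-yes (isPackingColoring? C₄ 4 (Vec.lookup (1F ∷ 2F ∷ 0F ∷ 3F ∷ [])))) (λ { 0F () ; 1F () }))
  C₄-with-two-adjacent-leaves-¬3-colorable
  (from-yes (all? λ v → any? λ w → adj? C₄-with-two-adjacent-leaves v w))
  (deleteEdge-colorings⇒colorable {C₄-with-two-adjacent-leaves} {colorings}
    (from-yes (deleteEdge-colorings? C₄-with-two-adjacent-leaves colorings)))
  where
    colorings : List (Vec (Fin 3) 6)
    colorings = (0F ∷ 1F ∷ 0F ∷ 2F ∷ 1F ∷ 0F ∷ [])
              ∷ (0F ∷ 1F ∷ 0F ∷ 2F ∷ 2F ∷ 0F ∷ [])
              ∷ (1F ∷ 0F ∷ 2F ∷ 0F ∷ 0F ∷ 2F ∷ [])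
              ∷ (1F ∷ 2F ∷ 0F ∷ 0F ∷ 0F ∷ 0F ∷ []) ∷ []

-- Critical graphs for each cycle length.

cycle-isCritical : ∀ {n} (3≤n : 3 ≤ n) → 5 ≤ n → n % 4 ≢ 0 → IsCritical 4 (cycle n 3≤n)
cycle-isCritical 3≤n 5≤n n%4≢0 = deleteEdge⇒isCritical (cycle-4-colorable 3≤n)
  (cycle-¬3-colorable 3≤n 5≤n n%4≢0)
  (λ v → proj₁ (successor v) , inj₁ (proj₂ (successor v)))
  (deleteEdge-cycle-3-colorable 3≤n)

-- The bare cycle is already not 3-colourable, so criticality leaves no room for leaves.
isCritical⇒≅cycle : ∀ {n} (3≤n : 3 ≤ n) vs → 5 ≤ n → n % 4 ≢ 0 →
  IsCritical 4 (attachLeaves (cycle n 3≤n) vs) → attachLeaves (cycle n 3≤n) vs ≅ cycle n 3≤n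
isCritical⇒≅cycle {n} 3≤n vs 5≤n n%4≢0 critical = ≅-trans
  (≅-sym (AttachMap.isCritical⇒≅ {cycle n 3≤n} {cycle n 3≤n} ≅-refl [] vs (λ ()) (λ { {()} }) (λ ()) critical
    (cycle-¬3-colorable 3≤n 5≤n n%4≢0 ∘ Iso.packingColorable (≅-sym (attachLeaves-[] (cycle n 3≤n))))))
  (attachLeaves-[] (cycle n 3≤n))

-- With a leaf at every vertex the net embeds. Otherwise some leafless vertex can take colour 1, as
-- can all leaves, while the other two triangle vertices take 2 and 3.
isCritical⇒≅net : ∀ vs → IsCritical 4 (attachLeaves C₃ vs) → attachLeaves C₃ vs ≅ net
isCritical⇒≅net vs critical with all? (λ v → any? λ l → lookup vs l ≟ v)
... | yes leafAt = ≅-sym (AttachMap.isCritical⇒≅ {C₃} {C₃} ≅-refl (0F ∷ 1F ∷ 2F ∷ []) vs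
        (proj₁ ∘ leafAt)
        (λ {i} {j} e → trans (sym (proj₂ (leafAt i))) (trans (cong (lookup vs) e) (proj₂ (leafAt j))))
        (λ { 0F → proj₂ (leafAt 0F) ; 1F → proj₂ (leafAt 1F) ; 2F → proj₂ (leafAt 2F) })
        critical net-¬3-colorable)
... | no ¬leafAt with v , leafless ← ¬∀⟶∃¬ 3 _ (λ v → any? λ l → lookup vs l ≟ v) ¬leafAt =
  contradiction
    (Attach.extendColoring C₃ vs (color v) (packing v) (λ l e → leafless (l , zero-only v (lookup vs l) e)))
    (isCritical⇒¬packingColorable critical)
  where
    color : Fin 3 → Fin 3 → Fin 3
    color v = Vec.lookup (Vec.lookup ((0F ∷ 1F ∷ 2F ∷ []) ∷ (1F ∷ 0F ∷ 2F ∷ []) ∷ (1F ∷ 2F ∷ 0F ∷ []) ∷ []) v)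
    packing : ∀ v → IsPackingColoring C₃ 3 (color v)
    packing = from-yes (all? λ v → isPackingColoring? C₃ 3 (color v))
    zero-only : ∀ v x → color v x ≡ 0F → x ≡ v
    zero-only = from-yes (all? λ v → all? λ x → (color v x ≟ 0F) →-dec (x ≟ v))

next-functional : ∀ {n} {i j k : Fin n} → Next i j → Next i k → j ≡ k
next-functional (inj₁ e) (inj₁ e′) = toℕ-injective (trans (sym e) e′)
next-functional {j = j} (inj₁ e) (inj₂ (e′ , _)) = contradiction (trans (sym e) e′) (ℕ.<⇒≢ (toℕ<n j))
next-functional {k = k} (inj₂ (e , _)) (inj₁ e′) = contradiction (trans (sym e′) e) (ℕ.<⇒≢ (toℕ<n k))
next-functional (inj₂ (_ , e)) (inj₂ (_ , e′)) = toℕ-injective (trans e (sym e′))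

-- Carries vertex 0 to `a`, so that leaves at any two consecutive vertices can be matched with those
-- at 0 and 1.
rotation : Fin 4 → C₄ ≅ C₄
rotation a = record
  { bijection = mk↔ₛ′ (rotate a) (unrotate a) (rotate∘unrotate a) (unrotate∘rotate a)
  ; adj-iff = λ x y → mk⇔ (rotate-adj a x y) (rotate-adj⁻ a x y)
  }
  where
    rotate unrotate : Fin 4 → Fin 4 → Fin 4
    rotate a x = orbit a (toℕ x)
    unrotate a y = orbit y (4 ∸ toℕ a)
    rotate∘unrotate : ∀ a y → rotate a (unrotate a y) ≡ y
    rotate∘unrotate = from-yes (all? λ a → all? λ y → rotate a (unrotate a y) ≟ y)
    unrotate∘rotate : ∀ a x → unrotate a (rotate a x) ≡ x
    unrotate∘rotate = from-yes (all? λ a → all? λ x → unrotate a (rotate a x) ≟ x)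
    rotate-adj : ∀ a x y → Adj C₄ x y → Adj C₄ (rotate a x) (rotate a y)
    rotate-adj = from-yes (all? λ a → all? λ x → all? λ y → adj? C₄ x y →-dec adj? C₄ (rotate a x) (rotate a y))
    rotate-adj⁻ : ∀ a x y → Adj C₄ (rotate a x) (rotate a y) → Adj C₄ x y
    rotate-adj⁻ = from-yes (all? λ a → all? λ x → all? λ y → adj? C₄ (rotate a x) (rotate a y) →-dec adj? C₄ x y)

adjacent-leaves⇒≅ : ∀ vs l l′ → Next (lookup vs l) (lookup vs l′) → IsCritical 4 (attachLeaves C₄ vs) →
                    attachLeaves C₄ vs ≅ C₄-with-two-adjacent-leaves
adjacent-leaves⇒≅ vs l l′ next critical = ≅-sym (AttachMap.isCritical⇒≅ {C₄} {C₄} (rotation (lookup vs l)) (0F ∷ 1F ∷ []) vs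
  σ σ-injective (λ { 0F → refl ; 1F → next-functional next (proj₂ (successor (lookup vs l))) })
  critical C₄-with-two-adjacent-leaves-¬3-colorable)
  where
    σ : Fin 2 → Fin (length vs)
    σ 0F = l
    σ 1F = l′
    l≢l′ : l ≢ l′
    l≢l′ refl = next-irrefl (s≤s (s≤s (s≤s z≤n))) (lookup vs l) next
    σ-injective : Injective _≡_ _≡_ σ
    σ-injective {0F} {0F} e = refl
    σ-injective {0F} {1F} e = contradiction e l≢l′
    σ-injective {1F} {0F} e = contradiction (sym e) l≢l′
    σ-injective {1F} {1F} e = refl

-- Colour 1 of the pattern 1, 2, 1, 3 sits exactly on the even positions.
Even : ℕ → Set
Even i = 1213-coloring i ≡ zero

even? : ∀ i → Dec (Even i)
even? i = 1213-coloring i ≟ zero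

-- If no leaf sat at an even position, the pattern with shift 0 would extend to the leaves; if none
-- at an odd one, the pattern with shift 1.
isCritical⇒both-parities : ∀ {n} (3≤n : 3 ≤ n) q → n ≡ q * 4 → ∀ vs → IsCritical 4 (attachLeaves (cycle n 3≤n) vs) →
  (∃ λ l → Even (toℕ (lookup vs l))) × (∃ λ l → ¬ Even (toℕ (lookup vs l)))
isCritical⇒both-parities {n} 3≤n q n≡ vs critical =
  decidable-stable (any? λ l → even? (toℕ (lookup vs l)))
    (λ none → ¬col (extendColoring _ (4∣n⇒isPackingColoring 3≤n q n≡ 0) (λ l e → none (l , e)))) ,
  decidable-stable (any? λ l → ¬? (even? (toℕ (lookup vs l))))
    (λ none → ¬col (extendColoring _ (4∣n⇒isPackingColoring 3≤n q n≡ 1) (λ l →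
      1213-zero-suc (toℕ (lookup vs l)) (decidable-stable (even? (toℕ (lookup vs l))) λ odd → none (l , odd)))))
  where
    open Attach (cycle n 3≤n) vs
    ¬col : ¬ PackingColorable (attachLeaves (cycle n 3≤n) vs) 3
    ¬col = isCritical⇒¬packingColorable critical

opposite-parity⇒adjacent : ∀ a b → Even (toℕ a) → ¬ Even (toℕ b) → Adj C₄ a b
opposite-parity⇒adjacent =
  from-yes (all? λ a → all? λ b → even? (toℕ a) →-dec (¬? (even? (toℕ b)) →-dec adj? C₄ a b))

isCritical⇒≅C₄-with-two-adjacent-leaves : ∀ vs → IsCritical 4 (attachLeaves C₄ vs) →
  attachLeaves C₄ vs ≅ C₄-with-two-adjacent-leaves
isCritical⇒≅C₄-with-two-adjacent-leaves vs critical
  with (l , even) , (l′ , odd) ← isCritical⇒both-parities (s≤s (s≤s (s≤s z≤n))) 1 refl vs critical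
  with opposite-parity⇒adjacent (lookup vs l) (lookup vs l′) even odd
... | inj₁ next = adjacent-leaves⇒≅ vs l l′ next critical
... | inj₂ next = adjacent-leaves⇒≅ vs l′ l next critical

-- Cycle lengths divisible by 4 from 8 on.

halve : ∀ d → ∃ λ k → d ≡ k * 2 ⊎ d ≡ 1 + k * 2
halve zero = 0 , inj₁ refl
halve (suc d) with halve d
... | k , inj₁ e = k , inj₂ (cong suc e)
... | k , inj₂ e = suc k , inj₁ (cong suc e)

even-+2k : ∀ k i → Even (k * 2 + i) → Even i
even-+2k zero    i e = e
even-+2k (suc k) i e = even-+2k k i (1213-zero-+2 (k * 2 + i) e)

even-+2k⁻ : ∀ k i → Even i → Even (k * 2 + i)
even-+2k⁻ zero    i e = e
even-+2k⁻ (suc k) i e = 1213-zero-+2⁻ (k * 2 + i) (even-+2k⁻ k i e)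

odd-gap : ∀ {i j} → i < j → ¬ ((Even i → Even j) × (Even j → Even i)) → ∃ λ k → 1 + k * 2 + i ≡ j
odd-gap {i} {j} i<j differ with halve (j ∸ i)
... | k , inj₂ e = k , trans (cong (_+ i) (sym e)) (ℕ.m∸n+n≡m (ℕ.<⇒≤ i<j))
... | k , inj₁ e = contradiction
        ((λ ev → subst Even sum (even-+2k⁻ k i ev)) , (λ ev → even-+2k k i (subst Even (sym sum) ev))) differ
  where
    sum : k * 2 + i ≡ j
    sum = trans (cong (_+ i) (sym e)) (ℕ.m∸n+n≡m (ℕ.<⇒≤ i<j))

-- The arcs have odd lengths `1 + k * 2` and `1 + k′ * 2` with sum `q * 4`. If the first is too
-- long, then `8 ≤ 5 + k * 2`, so `k` is at least 2 and the second arc falls short of the whole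
-- cycle by at least 5.
short-odd-arc : ∀ q k {a b} → 2 ≤ q → b < q * 4 → 1 + k * 2 + a ≡ b →
  6 + k * 2 ≤ q * 4 ⊎ ∃ λ k′ → 6 + k′ * 2 ≤ q * 4 × 1 + k′ * 2 + b ≡ q * 4 + a
short-odd-arc q k {a} {b} 2≤q b<n gap with 6 + k * 2 ≤? q * 4
... | yes short = inj₁ short
... | no ¬short = inj₂ (k′ , short , gap′)
  where
    open ℕ.≤-Reasoning
    k<2q : k < q * 2
    k<2q = ℕ.*-cancelʳ-< 2 k (q * 2) (begin-strict
      k * 2         ≤⟨ ℕ.m≤n+m (k * 2) 1 ⟩
      1 + k * 2     ≤⟨ ℕ.m≤m+n _ a ⟩
      1 + k * 2 + a ≡⟨ gap ⟩
      b             <⟨ b<n ⟩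
      q * 4         ≡⟨ ℕ.*-assoc q 2 2 ⟨
      q * 2 * 2     ∎)
    k′ : ℕ
    k′ = q * 2 ∸ suc k
    n≡ : q * 4 ≡ 2 + k * 2 + k′ * 2
    n≡ = trans (sym (ℕ.*-assoc q 2 2))
      (trans (cong (_* 2) (sym (ℕ.m+[n∸m]≡n k<2q))) (ℕ.*-distribʳ-+ 2 (suc k) k′))
    2≤k : 2 ≤ k
    2≤k = ℕ.*-cancelʳ-< 2 1 k (s≤s⁻¹ (s≤s⁻¹ (s≤s⁻¹ (s≤s⁻¹ (s≤s⁻¹ (begin
      8         ≤⟨ ℕ.*-monoˡ-≤ 4 2≤q ⟩
      q * 4     ≤⟨ s≤s⁻¹ (ℕ.≰⇒> ¬short) ⟩
      5 + k * 2 ∎))))))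
    short : 6 + k′ * 2 ≤ q * 4
    short = begin
      6 + k′ * 2         ≤⟨ ℕ.+-monoˡ-≤ (k′ * 2) (ℕ.+-monoʳ-≤ 2 (ℕ.*-monoˡ-≤ 2 2≤k)) ⟩
      2 + k * 2 + k′ * 2 ≡⟨ n≡ ⟨
      q * 4              ∎
    gap′ : 1 + k′ * 2 + b ≡ q * 4 + a
    gap′ = begin-equality
      1 + k′ * 2 + b               ≡⟨ cong (1 + k′ * 2 +_) gap ⟨
      1 + k′ * 2 + (1 + k * 2 + a) ≡⟨ rearrange (k * 2) (k′ * 2) a ⟩
      2 + k * 2 + k′ * 2 + a       ≡⟨ cong (_+ a) n≡ ⟨
      q * 4 + a                    ∎
      where
        rearrange : ∀ x y z → 1 + y + (1 + x + z) ≡ 2 + x + y + z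
        rearrange = solve-∀

odd-gap⇒¬isCritical : ∀ q (3≤n : 3 ≤ q * 4) → 2 ≤ q → ∀ vs l l′ k →
  1 + k * 2 + toℕ (lookup vs l) ≡ toℕ (lookup vs l′) → ¬ IsCritical 4 (attachLeaves (cycle (q * 4) 3≤n) vs)
odd-gap⇒¬isCritical q 3≤n 2≤q vs l l′ k gap with short-odd-arc q k 2≤q (toℕ<n (lookup vs l′)) gap
... | inj₁ short               = odd-leaf-distance⇒¬isCritical 3≤n vs l l′ k short (inj₁ gap)
... | inj₂ (k′ , short , gap′) = odd-leaf-distance⇒¬isCritical 3≤n vs l′ l k′ short (inj₂ gap′)

4∣n⇒¬isCritical : ∀ q (3≤n : 3 ≤ q * 4) → 2 ≤ q → ∀ vs → ¬ IsCritical 4 (attachLeaves (cycle (q * 4) 3≤n) vs)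
4∣n⇒¬isCritical q 3≤n 2≤q vs critical
  with (l , even) , (l′ , odd) ← isCritical⇒both-parities 3≤n q refl vs critical
  with ℕ.<-cmp (toℕ (lookup vs l)) (toℕ (lookup vs l′))
... | tri< lt _ _ with k , gap ← odd-gap lt (λ (p , _) → odd (p even)) =
  odd-gap⇒¬isCritical q 3≤n 2≤q vs l l′ k gap critical
... | tri≈ _ eq _ = odd (subst Even eq even)
... | tri> _ _ gt with k , gap ← odd-gap gt (λ (_ , p) → odd (p even)) =
  odd-gap⇒¬isCritical q 3≤n 2≤q vs l′ l k gap critical

-- The classification.

Exceptional : Graph → Set
Exceptional G = (∃ λ n → Σ (3 ≤ n) λ 3≤n → 5 ≤ n × n % 4 ≢ 0 × G ≅ cycle n 3≤n)
              ⊎ G ≅ net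
              ⊎ G ≅ C₄-with-two-adjacent-leaves

exceptional-resp-≅ : ∀ {G H} → G ≅ H → Exceptional H → Exceptional G
exceptional-resp-≅ φ (inj₁ (n , 3≤n , 5≤n , n%4≢0 , ψ)) = inj₁ (n , 3≤n , 5≤n , n%4≢0 , ≅-trans φ ψ)
exceptional-resp-≅ φ (inj₂ (inj₁ ψ)) = inj₂ (inj₁ (≅-trans φ ψ))
exceptional-resp-≅ φ (inj₂ (inj₂ ψ)) = inj₂ (inj₂ (≅-trans φ ψ))

isCritical⇒exceptional-4∣ : ∀ {n} (3≤n : 3 ≤ n) q → n ≡ q * 4 → ∀ vs →
  IsCritical 4 (attachLeaves (cycle n 3≤n) vs) → Exceptional (attachLeaves (cycle n 3≤n) vs)
isCritical⇒exceptional-4∣ () zero refl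
-- Matching on the proof of `3 ≤ 4` makes the cycle literally `C₄`.
isCritical⇒exceptional-4∣ (s≤s (s≤s (s≤s z≤n))) 1 refl vs critical =
  inj₂ (inj₂ (isCritical⇒≅C₄-with-two-adjacent-leaves vs critical))
isCritical⇒exceptional-4∣ 3≤n (suc (suc q)) refl vs critical =
  contradiction critical (4∣n⇒¬isCritical (2 + q) 3≤n (s≤s (s≤s z≤n)) vs)

isCritical⇒exceptional : ∀ {n} (3≤n : 3 ≤ n) vs →
  IsCritical 4 (attachLeaves (cycle n 3≤n) vs) → Exceptional (attachLeaves (cycle n 3≤n) vs)
isCritical⇒exceptional {3} (s≤s (s≤s (s≤s z≤n))) vs critical = inj₂ (inj₁ (isCritical⇒≅net vs critical))
isCritical⇒exceptional {4} 3≤n vs critical = isCritical⇒exceptional-4∣ 3≤n 1 refl vs critical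
isCritical⇒exceptional {n@(suc (suc (suc (suc (suc _)))))} 3≤n vs critical with n % 4 ℕ.≟ 0
... | yes n%4≡0 = isCritical⇒exceptional-4∣ 3≤n (n / 4)
                    (trans (m≡m%n+[m/n]*n n 4) (cong (_+ n / 4 * 4) n%4≡0)) vs critical
... | no  n%4≢0 = inj₁ (n , 3≤n , 5≤n , n%4≢0 , isCritical⇒≅cycle 3≤n vs 5≤n n%4≢0 critical)
  where
    5≤n : 5 ≤ n
    5≤n = s≤s (s≤s (s≤s (s≤s (s≤s z≤n))))
isCritical⇒exceptional {1} (s≤s ())
isCritical⇒exceptional {2} (s≤s (s≤s ()))

exceptional⇒isCritical : ∀ {G} → Exceptional G → IsCritical 4 G
exceptional⇒isCritical (inj₁ (n , 3≤n , 5≤n , n%4≢0 , φ)) =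
  isCritical-resp-≅ (≅-sym φ) (cycle-isCritical 3≤n 5≤n n%4≢0)
exceptional⇒isCritical (inj₂ (inj₁ φ)) = isCritical-resp-≅ (≅-sym φ) net-isCritical
exceptional⇒isCritical (inj₂ (inj₂ φ)) = isCritical-resp-≅ (≅-sym φ) C₄-with-two-adjacent-leaves-isCritical

theorem3p4 : (G : Graph) → InClassC G →
    (IsCritical 4 G ⇔
    ((∃ λ n → Σ (3 ≤ n) λ 3≤n → 5 ≤ n × n % 4 ≢ 0 × G ≅ cycle n 3≤n)
    ⊎ G ≅ net
    ⊎ G ≅ C₄-with-two-adjacent-leaves))
theorem3p4 G (m , 3≤m , vs , φ) = mk⇔
  (exceptional-resp-≅ φ ∘ isCritical⇒exceptional 3≤m vs ∘ isCritical-resp-≅ φ)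
  exceptional⇒isCritical
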